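{- Let $(X,d)$ be a (nonempty) geodesic space. Then the following are equivalent: (1) $\operatorname{UBG}(X)=\operatorname{UBG}(\mathbb{R})$. (2) $X$ is isometric to an interval (a convex subset of $\mathbb{R}$) which is not the single-point space.
   Context: All graphs are finite, simple and undirected. A geodesic from $x$ to $y$ in a metric space $(X,d)$ is a distance-preserving map $\gamma\colon[0,d(x,y)]\to X$ with $\gamma(0)=x$, $\gamma(d(x,y))=y$; $(X,d)$ is a geodesic space if every two points are joined by a geodesic. A graph $G=(V_G,E_G)$ is a unit ball graph on $(X,d)$ if there exist $\delta>0$ and a map $\rho\colon V_G\to X$ such that for distinct $u,v\in V_G$, $\{u,v\}\in E_G$ if and only if $d(\rho(u),\rho(v))\le\delta$. $\operatorname{UBG}(X)$ denotes the collection of all unit ball graphs on $X$. $\mathbb{R}$ carries its usual metric. -}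

module Defs where

open import Data.Fin using (Fin)
open import Data.Integer using (+_)
open import Data.Nat as ℕ using (ℕ)
import Data.Nat.Properties as ℕ
open import Data.Product using (Σ; Σ-syntax; ∃-syntax; _×_; _,_; proj₁; proj₂)
open import Data.Rational as ℚ using (ℚ; 0ℚ; ½)
import Data.Rational.Properties as ℚ
open import Data.Rational.Solver using (module +-*-Solver)
open import Data.Sum using (inj₁; inj₂)
open import Function using (_⇔_; mk⇔; _↔_; _on_)
open import Function.Definitions using (Surjective)
open import Level using (Level; _⊔_; 0ℓ) renaming (suc to lsuc)
open import Relation.Binary
  using (Rel; IsEquivalence; Reflexive; Symmetric; Irreflexive)
import Relation.Binary.Construct.On as On
open import Relation.Binary.PropositionalEquality
  using (_≡_; _≢_; refl; sym; trans; cong; subst)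
open import Relation.Unary using (Pred)

private
  variable
    a b p r : Level

------------------------------------------------------------------------
-- The real numbers, as Cauchy sequences of rationals. The library has no
-- quotients, so equality of reals is the equivalence relation _≃_.

Eventually : (ℕ → Set) → Set
Eventually P = ∃[ N ] (∀ n → N ℕ.≤ n → P n)

record ℝ : Set where
  constructor mkℝ
  field
    seq    : ℕ → ℚ
    cauchy : ∀ ε → 0ℚ ℚ.< ε →
             ∃[ N ] (∀ m n → N ℕ.≤ m → N ℕ.≤ n → ℚ.∣ seq m ℚ.- seq n ∣ ℚ.≤ ε)

open ℝ public

infix 8 -_
infix 4 _≃_ _≤_ _<_
infixl 6 _+_ _-_

_≃_ : Rel ℝ 0ℓ
x ≃ y = ∀ ε → 0ℚ ℚ.< ε → Eventually λ n → ℚ.∣ seq x n ℚ.- seq y n ∣ ℚ.≤ ε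

_≤_ : Rel ℝ 0ℓ
x ≤ y = ∀ ε → 0ℚ ℚ.< ε → Eventually λ n → seq x n ℚ.≤ seq y n ℚ.+ ε

_<_ : Rel ℝ 0ℓ
x < y = ∃[ ε ] (0ℚ ℚ.< ε × Eventually λ n → seq x n ℚ.+ ε ℚ.≤ seq y n)

private
  open +-*-Solver using (solve; _:=_; _:+_; _:-_; :-_; _:*_)

  half>0 : ∀ {ε} → 0ℚ ℚ.< ε → 0ℚ ℚ.< ½ ℚ.* ε
  half>0 {ε} ε>0 = subst (ℚ._< ½ ℚ.* ε) (ℚ.*-zeroʳ ½) (ℚ.*-monoʳ-<-pos ½ ε>0)

  half+half : ∀ ε → ½ ℚ.* ε ℚ.+ ½ ℚ.* ε ≡ ε
  half+half ε = trans (sym (ℚ.*-distribʳ-+ ε ½ ½)) (ℚ.*-identityˡ ε)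

  ∣p-p∣≡0 : ∀ p → ℚ.∣ p ℚ.- p ∣ ≡ 0ℚ
  ∣p-p∣≡0 p = cong ℚ.∣_∣ (ℚ.+-inverseʳ p)

  ∣p-q∣≡∣q-p∣ : ∀ p q → ℚ.∣ p ℚ.- q ∣ ≡ ℚ.∣ q ℚ.- p ∣
  ∣p-q∣≡∣q-p∣ p q = trans
    (cong ℚ.∣_∣ (solve 2 (λ p q → p :- q := :- (q :- p)) refl p q))
    (ℚ.∣-p∣≡∣p∣ (q ℚ.- p))

  ∣p-q∣-triangle : ∀ p q r → ℚ.∣ p ℚ.- r ∣ ℚ.≤ ℚ.∣ p ℚ.- q ∣ ℚ.+ ℚ.∣ q ℚ.- r ∣
  ∣p-q∣-triangle p q r = subst (ℚ._≤ ℚ.∣ p ℚ.- q ∣ ℚ.+ ℚ.∣ q ℚ.- r ∣)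
    (cong ℚ.∣_∣ (solve 3 (λ p q r → (p :- q) :+ (q :- r) := p :- r) refl p q r))
    (ℚ.∣p+q∣≤∣p∣+∣q∣ (p ℚ.- q) (q ℚ.- r))

  ≤-shift : ∀ p q r → p ℚ.≤ r ℚ.+ q → p ℚ.- q ℚ.≤ r
  ≤-shift p q r h = subst (p ℚ.- q ℚ.≤_)
    (solve 2 (λ r q → (r :+ q) :- q := r) refl r q)
    (ℚ.+-monoˡ-≤ (ℚ.- q) h)

  ∣p∣-∣q∣≤∣p-q∣ : ∀ p q → ℚ.∣ p ∣ ℚ.- ℚ.∣ q ∣ ℚ.≤ ℚ.∣ p ℚ.- q ∣
  ∣p∣-∣q∣≤∣p-q∣ p q = ≤-shift ℚ.∣ p ∣ ℚ.∣ q ∣ _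
    (subst (λ z → ℚ.∣ z ∣ ℚ.≤ ℚ.∣ p ℚ.- q ∣ ℚ.+ ℚ.∣ q ∣)
      (solve 2 (λ p q → (p :- q) :+ q := p) refl p q)
      (ℚ.∣p+q∣≤∣p∣+∣q∣ (p ℚ.- q) q))

  ∣∣p∣-∣q∣∣≤∣p-q∣ : ∀ p q → ℚ.∣ ℚ.∣ p ∣ ℚ.- ℚ.∣ q ∣ ∣ ℚ.≤ ℚ.∣ p ℚ.- q ∣
  ∣∣p∣-∣q∣∣≤∣p-q∣ p q with ℚ.∣p∣≡p∨∣p∣≡-p (ℚ.∣ p ∣ ℚ.- ℚ.∣ q ∣)
  ... | inj₁ eq = subst (ℚ._≤ ℚ.∣ p ℚ.- q ∣) (sym eq) (∣p∣-∣q∣≤∣p-q∣ p q)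
  ... | inj₂ eq = subst (ℚ._≤ ℚ.∣ p ℚ.- q ∣)
    (sym (trans eq (solve 2 (λ a b → :- (a :- b) := b :- a) refl ℚ.∣ p ∣ ℚ.∣ q ∣)))
    (subst (ℚ.∣ q ∣ ℚ.- ℚ.∣ p ∣ ℚ.≤_) (∣p-q∣≡∣q-p∣ q p) (∣p∣-∣q∣≤∣p-q∣ q p))

  always : ∀ {P : ℕ → Set} → (∀ n → P n) → Eventually P
  always f = 0 , λ n _ → f n

  ev-map : ∀ {P Q : ℕ → Set} → (∀ n → P n → Q n) → Eventually P → Eventually Q
  ev-map f (N , h) = N , λ n N≤n → f n (h n N≤n)

  ev-× : ∀ {P Q : ℕ → Set} → Eventually P → Eventually Q → Eventually λ n → P n × Q n
  ev-× (M , g) (N , h) = M ℕ.⊔ N , λ n le →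
    g n (ℕ.≤-trans (ℕ.m≤m⊔n M N) le) , h n (ℕ.≤-trans (ℕ.m≤n⊔m M N) le)

  p≤p+ε : ∀ p {ε} → 0ℚ ℚ.< ε → p ℚ.≤ p ℚ.+ ε
  p≤p+ε p {ε} ε>0 = subst (ℚ._≤ p ℚ.+ ε) (ℚ.+-identityʳ p) (ℚ.+-monoʳ-≤ p (ℚ.<⇒≤ ε>0))

0ℝ : ℝ
0ℝ = mkℝ (λ _ → 0ℚ) λ ε ε>0 → 0 , λ _ _ _ _ → ℚ.<⇒≤ ε>0

_+_ : ℝ → ℝ → ℝ
x + y = mkℝ (λ n → seq x n ℚ.+ seq y n) λ ε ε>0 →
  let M , g = cauchy x (½ ℚ.* ε) (half>0 ε>0)
      N , h = cauchy y (½ ℚ.* ε) (half>0 ε>0)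
  in M ℕ.⊔ N , λ m n le le′ → begin
    ℚ.∣ (seq x m ℚ.+ seq y m) ℚ.- (seq x n ℚ.+ seq y n) ∣
      ≡⟨ cong ℚ.∣_∣ (solve 4 (λ a b c d → (a :+ b) :- (c :+ d) := (a :- c) :+ (b :- d))
           refl (seq x m) (seq y m) (seq x n) (seq y n)) ⟩
    ℚ.∣ (seq x m ℚ.- seq x n) ℚ.+ (seq y m ℚ.- seq y n) ∣
      ≤⟨ ℚ.∣p+q∣≤∣p∣+∣q∣ (seq x m ℚ.- seq x n) (seq y m ℚ.- seq y n) ⟩
    ℚ.∣ seq x m ℚ.- seq x n ∣ ℚ.+ ℚ.∣ seq y m ℚ.- seq y n ∣
      ≤⟨ ℚ.+-mono-≤
           (g m n (ℕ.≤-trans (ℕ.m≤m⊔n M N) le) (ℕ.≤-trans (ℕ.m≤m⊔n M N) le′))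
           (h m n (ℕ.≤-trans (ℕ.m≤n⊔m M N) le) (ℕ.≤-trans (ℕ.m≤n⊔m M N) le′)) ⟩
    ½ ℚ.* ε ℚ.+ ½ ℚ.* ε
      ≡⟨ half+half ε ⟩
    ε ∎
  where open ℚ.≤-Reasoning

-_ : ℝ → ℝ
- x = mkℝ (λ n → ℚ.- seq x n) λ ε ε>0 →
  let N , h = cauchy x ε ε>0
  in N , λ m n le le′ → subst (ℚ._≤ ε)
       (trans (∣p-q∣≡∣q-p∣ (seq x m) (seq x n))
         (cong ℚ.∣_∣ (solve 2 (λ a b → b :- a := (:- a) :- (:- b)) refl (seq x m) (seq x n))))
       (h m n le le′)

_-_ : ℝ → ℝ → ℝ
x - y = x + (- y)

∣_∣ : ℝ → ℝ
∣ x ∣ = mkℝ (λ n → ℚ.∣ seq x n ∣) λ ε ε>0 →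
  let N , h = cauchy x ε ε>0
  in N , λ m n le le′ → ℚ.≤-trans (∣∣p∣-∣q∣∣≤∣p-q∣ (seq x m) (seq x n)) (h m n le le′)

≃-isEquivalence : IsEquivalence _≃_
≃-isEquivalence = record
  { refl  = λ {x} ε ε>0 → always λ n →
      subst (ℚ._≤ ε) (sym (∣p-p∣≡0 (seq x n))) (ℚ.<⇒≤ ε>0)
  ; sym   = λ {x} {y} x≃y ε ε>0 →
      ev-map (λ n → subst (ℚ._≤ ε) (∣p-q∣≡∣q-p∣ (seq x n) (seq y n))) (x≃y ε ε>0)
  ; trans = λ {x} {y} {z} x≃y y≃z ε ε>0 →
      ev-map
        (λ n (h , k) → ℚ.≤-trans (∣p-q∣-triangle (seq x n) (seq y n) (seq z n))
          (subst (_ ℚ.≤_) (half+half ε) (ℚ.+-mono-≤ h k)))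
        (ev-× (x≃y (½ ℚ.* ε) (half>0 ε>0)) (y≃z (½ ℚ.* ε) (half>0 ε>0)))
  }

------------------------------------------------------------------------
-- Metric spaces; the points form a setoid, so that ℝ itself is one.

record MetricSpace a b : Set (lsuc (a ⊔ b)) where
  infix 4 _≈_
  field
    Carrier       : Set a
    _≈_           : Rel Carrier b
    isEquivalence : IsEquivalence _≈_
    d             : Carrier → Carrier → ℝ
    d-nonneg      : ∀ x y → 0ℝ ≤ d x y
    d≃0⇔≈         : ∀ x y → d x y ≃ 0ℝ ⇔ x ≈ y
    d-sym         : ∀ x y → d x y ≃ d y x
    d-triangle    : ∀ x y z → d x z ≤ d x y + d y z

ℝ-space : MetricSpace 0ℓ 0ℓ
ℝ-space = record
  { Carrier       = ℝ
  ; _≈_           = _≃_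
  ; isEquivalence = ≃-isEquivalence
  ; d             = λ x y → ∣ x - y ∣
  ; d-nonneg      = λ x y ε ε>0 → always λ n →
      ℚ.≤-trans (ℚ.0≤∣p∣ (seq x n ℚ.- seq y n)) (p≤p+ε _ ε>0)
  ; d≃0⇔≈         = λ x y → mk⇔
      (λ h ε ε>0 → ev-map (λ n → subst (ℚ._≤ ε) (∣∣p∣-0∣ (seq x n ℚ.- seq y n))) (h ε ε>0))
      (λ h ε ε>0 → ev-map (λ n → subst (ℚ._≤ ε) (sym (∣∣p∣-0∣ (seq x n ℚ.- seq y n)))) (h ε ε>0))
  ; d-sym         = λ x y ε ε>0 → always λ n → subst (ℚ._≤ ε)
      (sym (trans (cong (λ z → ℚ.∣ z ℚ.- ℚ.∣ seq y n ℚ.- seq x n ∣ ∣)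
                    (∣p-q∣≡∣q-p∣ (seq x n) (seq y n)))
                  (∣p-p∣≡0 ℚ.∣ seq y n ℚ.- seq x n ∣)))
      (ℚ.<⇒≤ ε>0)
  ; d-triangle    = λ x y z ε ε>0 → always λ n →
      ℚ.≤-trans (∣p-q∣-triangle (seq x n) (seq y n) (seq z n)) (p≤p+ε _ ε>0)
  }
  where
  ∣∣p∣-0∣ : ∀ p → ℚ.∣ ℚ.∣ p ∣ ℚ.- 0ℚ ∣ ≡ ℚ.∣ p ∣
  ∣∣p∣-0∣ p = trans (cong ℚ.∣_∣ (ℚ.+-identityʳ ℚ.∣ p ∣)) (ℚ.∣∣p∣∣≡∣p∣ p)

module _ (X : MetricSpace a b) where
  open MetricSpace X

  Subspace : Pred Carrier p → MetricSpace (a ⊔ p) b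
  Subspace P = record
    { Carrier       = Σ Carrier P
    ; _≈_           = _≈_ on proj₁
    ; isEquivalence = On.isEquivalence proj₁ isEquivalence
    ; d             = λ x y → d (proj₁ x) (proj₁ y)
    ; d-nonneg      = λ x y → d-nonneg (proj₁ x) (proj₁ y)
    ; d≃0⇔≈         = λ x y → d≃0⇔≈ (proj₁ x) (proj₁ y)
    ; d-sym         = λ x y → d-sym (proj₁ x) (proj₁ y)
    ; d-triangle    = λ x y z → d-triangle (proj₁ x) (proj₁ y) (proj₁ z)
    }

  IsSinglePoint : Set (a ⊔ b)
  IsSinglePoint = ∃[ x ] (∀ y → y ≈ x)

module _ (X : MetricSpace a b) (Y : MetricSpace p r) where
  private
    module X = MetricSpace X
    module Y = MetricSpace Y

  DistancePreserving : (X.Carrier → Y.Carrier) → Set a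
  DistancePreserving f = ∀ x x′ → Y.d (f x) (f x′) ≃ X.d x x′

  -- A distance-preserving map automatically respects and reflects equality
  -- of points, so only surjectivity has to be demanded.
  Isometric : Set (a ⊔ b ⊔ p ⊔ r)
  Isometric = ∃[ f ] (DistancePreserving f × Surjective X._≈_ Y._≈_ f)

------------------------------------------------------------------------
-- Geodesics

[0,_] : ℝ → Pred ℝ 0ℓ
[0, r ] t = 0ℝ ≤ t × t ≤ r

≤-refl : Reflexive _≤_
≤-refl {x} ε ε>0 = always λ n → p≤p+ε (seq x n) ε>0

module _ (X : MetricSpace a b) where
  open MetricSpace X

  record Geodesic (x y : Carrier) : Set (a ⊔ b) where
    field
      γ          : Σ ℝ [0, d x y ] → Carrier
      preserving : DistancePreserving (Subspace ℝ-space [0, d x y ]) X γ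
      start      : γ (0ℝ , ≤-refl {0ℝ} , d-nonneg x y) ≈ x
      end        : γ (d x y , d-nonneg x y , ≤-refl {d x y}) ≈ y

  IsGeodesicSpace : Set (a ⊔ b)
  IsGeodesicSpace = ∀ x y → Geodesic x y

-- Taking y = x and z ≃ x shows that a convex I respects _≃_, i.e. that it
-- is a genuine subset of the reals.
Convex : Pred ℝ p → Set p
Convex I = ∀ x y z → I x → I y → x ≤ z → z ≤ y → I z

------------------------------------------------------------------------
-- Unit ball graphs

record Graph : Set₁ where
  field
    V           : Set
    finite      : ∃[ n ] (V ↔ Fin n)
    E           : Rel V 0ℓ
    symmetric   : Symmetric E
    irreflexive : Irreflexive _≡_ E

UBG : MetricSpace a b → Pred Graph a
UBG X G = ∃[ δ ] (0ℝ < δ × Σ[ ρ ∈ (V → Carrier) ] (∀ u v → u ≢ v → E u v ⇔ d (ρ u) (ρ v) ≤ δ))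
  where
  open MetricSpace X
  open Graph G

{-# OPTIONS --safe #-}

-- To pass from graphs to the metric, sample the geodesics between finitely
-- many points P i of X so finely that consecutive samples have distance at
-- most ε, and let f represent the resulting unit ball graph on ℝ. If f (P j)
-- lies between f (P i) and f (P k), then f jumps over f (P j) along the sampled
-- geodesic from P i to P k, so some sample is a neighbour of P j; hence
-- d (P i) (P j) + d (P j) (P k) ≤ d (P i) (P k) + 2ε. For ε below the finitely
-- many positive gaps this is an exact betweenness relation, and the distance
-- from a leftmost P i embeds the finite set isometrically in ℝ. The embeddings
-- of four-point sets {o, e, x, y} with o and e fixed are glued: the coordinate
-- of x is the unique s with |s| = d (o, x) and |d (o, e) - s| = d (e, x).
-- Conversely, an affine map squeezes any finite subset of ℝ into a given
-- nondegenerate interval.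

module Submission where

open import Defs
open import Axiom.ExcludedMiddle using (ExcludedMiddle)
open import Data.Empty using (⊥)
open import Data.Fin as Fin using (Fin; zero; suc)
import Data.Fin.Properties as Fin
import Data.Integer as ℤ
import Data.Integer.Properties as ℤ
open import Data.Nat as ℕ using (ℕ; zero; suc)
import Data.Nat.Properties as ℕ
open import Data.Product using (Σ; Σ-syntax; ∃-syntax; _×_; _,_; proj₁; proj₂)
open import Data.Product.Function.NonDependent.Propositional using (_×-↔_)
open import Data.Rational as ℚ using (ℚ; 0ℚ; 1ℚ; ½)
import Data.Rational.Properties as ℚ
open import Data.Rational.Solver using (module +-*-Solver)
import Data.Rational.Unnormalised as ℚᵘ
import Data.Rational.Unnormalised.Properties as ℚᵘ
open import Data.Sum using (_⊎_; inj₁; inj₂)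
open import Data.Sum.Function.Propositional using (_⊎-↔_)
open import Data.Vec using ([]; _∷_; lookup)
open import Function using (_⇔_; mk⇔; Equivalence; Inverse; case_of_)
open import Function.Properties.Inverse using (↔-refl; ↔-sym; ↔-trans)
open import Level using (0ℓ; _⊔_; Lift; lift; lower)
open import Relation.Binary using (IsEquivalence)
open import Relation.Binary.PropositionalEquality
  using (_≡_; _≢_; refl; sym; trans; cong; subst; subst₂)
open import Relation.Nullary using (¬_; yes; no; contradiction)
open import Relation.Nullary.Decidable using (map′; True; toWitness; fromWitness)
open import Relation.Unary using (Pred; _⊆_; _≐_)

open +-*-Solver using (solve; _:=_; _:+_; _:-_; :-_; _:*_; con)

-- From one instance at level `a ⊔ b` this gives the two that are used: level 0 for comparing reals,
-- and level `a` for asking whether a real has a preimage in the space.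
em-lower : ∀ {ℓ} ℓ′ → ExcludedMiddle (ℓ ⊔ ℓ′) → ExcludedMiddle ℓ
em-lower ℓ′ em {P} = map′ lower lift (em {Lift ℓ′ P})

-- Eventual properties of sequences.

always : ∀ {P : ℕ → Set} → (∀ n → P n) → Eventually P
always f = 0 , λ n _ → f n

ev-map : ∀ {P Q : ℕ → Set} → (∀ n → P n → Q n) → Eventually P → Eventually Q
ev-map f (N , h) = N , λ n N≤n → f n (h n N≤n)

ev-zip : ∀ {P Q R : ℕ → Set} → (∀ n → P n → Q n → R n) →
  Eventually P → Eventually Q → Eventually R
ev-zip f (M , g) (N , h) = M ℕ.⊔ N , λ n le →
  f n (g n (ℕ.≤-trans (ℕ.m≤m⊔n M N) le)) (h n (ℕ.≤-trans (ℕ.m≤n⊔m M N) le))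

ev-extract : ∀ {P : ℕ → Set} → Eventually P → ∃[ n ] P n
ev-extract (N , h) = N , h N ℕ.≤-refl

-- The largest of finitely many thresholds serves them all. It yields one fineness for all pairs and
-- triples of points, and one bound for all vertices of a graph.
ev-fin : ∀ {k} {P : Fin k → ℕ → Set} →
  (∀ i → Eventually (P i)) → Eventually λ n → ∀ i → P i n
ev-fin {zero}  h = always λ _ ()
ev-fin {suc k} h = ev-zip (λ { n p q zero → p ; n p q (suc i) → q i })
  (h zero) (ev-fin (λ i → h (suc i)))

-- Rational arithmetic.

+-cancelʳ-≤ : ∀ r {p q} → p ℚ.+ r ℚ.≤ q ℚ.+ r → p ℚ.≤ q
+-cancelʳ-≤ r {p} {q} h = subst₂ ℚ._≤_ (+-cancel p) (+-cancel q) (ℚ.+-monoˡ-≤ (ℚ.- r) h)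
  where
  +-cancel : ∀ p → p ℚ.+ r ℚ.- r ≡ p
  +-cancel p = solve 2 (λ p r → p :+ r :- r := p) refl p r

-p≤∣p∣ : ∀ p → ℚ.- p ℚ.≤ ℚ.∣ p ∣
-p≤∣p∣ p with ℚ.≤-total 0ℚ p
... | inj₁ 0≤p = ℚ.≤-trans (ℚ.neg-antimono-≤ 0≤p) (ℚ.0≤∣p∣ p)
... | inj₂ p≤0 = ℚ.≤-reflexive (trans (sym (ℚ.0≤p⇒∣p∣≡p (ℚ.neg-antimono-≤ p≤0))) (ℚ.∣-p∣≡∣p∣ p))

p≤∣p∣ : ∀ p → p ℚ.≤ ℚ.∣ p ∣
p≤∣p∣ p = subst₂ ℚ._≤_ (solve 1 (λ p → :- (:- p) := p) refl p) (ℚ.∣-p∣≡∣p∣ p) (-p≤∣p∣ (ℚ.- p))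

∣p∣≤ : ∀ {p q} → p ℚ.≤ q → ℚ.- p ℚ.≤ q → ℚ.∣ p ∣ ℚ.≤ q
∣p∣≤ {p} {q} h k with ℚ.∣p∣≡p∨∣p∣≡-p p
... | inj₁ eq = subst (ℚ._≤ q) (sym eq) h
... | inj₂ eq = subst (ℚ._≤ q) (sym eq) k

*-pos : ∀ {p q} → 0ℚ ℚ.< p → 0ℚ ℚ.< q → 0ℚ ℚ.< p ℚ.* q
*-pos {p} {q} p>0 q>0 = subst (ℚ._< p ℚ.* q) (ℚ.*-zeroʳ p)
  (ℚ.*-monoʳ-<-pos p {{ℚ.positive p>0}} q>0)

*-monoˡ-≤ : ∀ {r p q} → 0ℚ ℚ.≤ r → p ℚ.≤ q → r ℚ.* p ℚ.≤ r ℚ.* q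
*-monoˡ-≤ {r} r≥0 = ℚ.*-monoˡ-≤-nonNeg r {{ℚ.nonNegative r≥0}}

half>0 : ∀ {ε} → 0ℚ ℚ.< ε → 0ℚ ℚ.< ½ ℚ.* ε
half>0 = *-pos (ℚ.positive⁻¹ ½)

half+half : ∀ ε → ½ ℚ.* ε ℚ.+ ½ ℚ.* ε ≡ ε
half+half ε = trans (sym (ℚ.*-distribʳ-+ ε ½ ½)) (ℚ.*-identityˡ ε)

inverse : ∀ {q} → 0ℚ ℚ.< q → ∃[ r ] (0ℚ ℚ.< r × r ℚ.* q ≡ 1ℚ)
inverse {q} q>0 = ℚ.1/_ q {{nz}} ,
  ℚ.positive⁻¹ _ {{ℚ.1/pos⇒pos q {{ℚ.positive q>0}}}} , ℚ.*-inverseˡ q {{nz}}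
  where
  nz : ℚ.NonZero q
  nz = ℚ.pos⇒nonZero q {{ℚ.positive q>0}}

shrink : ∀ q {ε} → 0ℚ ℚ.< ε → ∃[ ε′ ] (0ℚ ℚ.< ε′ × ℚ.∣ q ∣ ℚ.* ε′ ℚ.≤ ε)
shrink q {ε} ε>0 =
  -- The witness is `ε / (∣ q ∣ + 1)`; the summand 1 keeps the denominator positive when `q` is 0.
  let r , r>0 , eq = inverse {ℚ.∣ q ∣ ℚ.+ 1ℚ} (ℚ.+-mono-≤-< (ℚ.0≤∣p∣ q) (ℚ.positive⁻¹ 1ℚ))
  in r ℚ.* ε , *-pos r>0 ε>0 , (begin
    ℚ.∣ q ∣ ℚ.* (r ℚ.* ε)
      ≡⟨ ℚ.+-identityʳ _ ⟨
    ℚ.∣ q ∣ ℚ.* (r ℚ.* ε) ℚ.+ 0ℚ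
      ≤⟨ ℚ.+-monoʳ-≤ (ℚ.∣ q ∣ ℚ.* (r ℚ.* ε)) (ℚ.<⇒≤ (*-pos r>0 ε>0)) ⟩
    ℚ.∣ q ∣ ℚ.* (r ℚ.* ε) ℚ.+ r ℚ.* ε
      ≡⟨ solve 3 (λ q r ε → q :* (r :* ε) :+ r :* ε := (r :* (q :+ con 1ℚ)) :* ε)
           refl ℚ.∣ q ∣ r ε ⟩
    (r ℚ.* (ℚ.∣ q ∣ ℚ.+ 1ℚ)) ℚ.* ε
      ≡⟨ cong (ℚ._* ε) eq ⟩
    1ℚ ℚ.* ε
      ≡⟨ ℚ.*-identityˡ ε ⟩
    ε ∎)
  where open ℚ.≤-Reasoning

-- The Archimedean property.

fromℕ : ℕ → ℚ
fromℕ zero    = 0ℚ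
fromℕ (suc n) = 1ℚ ℚ.+ fromℕ n

fromℕ-suc : ∀ n → fromℕ n ℚ.≤ fromℕ (suc n)
fromℕ-suc n = subst (ℚ._≤ fromℕ (suc n)) (ℚ.+-identityˡ (fromℕ n))
  (ℚ.+-monoˡ-≤ (fromℕ n) (ℚ.<⇒≤ (ℚ.positive⁻¹ 1ℚ)))

fromℕ-mono : ∀ {m n} → m ℕ.≤ n → fromℕ m ℚ.≤ fromℕ n
fromℕ-mono {n = zero}  ℕ.z≤n       = ℚ.≤-refl
fromℕ-mono {n = suc n} ℕ.z≤n       = ℚ.≤-trans (fromℕ-mono {n = n} ℕ.z≤n) (fromℕ-suc n)
fromℕ-mono             (ℕ.s≤s m≤n) = ℚ.+-monoʳ-≤ 1ℚ (fromℕ-mono m≤n)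

0<fromℕ-suc : ∀ n → 0ℚ ℚ.< fromℕ (suc n)
0<fromℕ-suc n = ℚ.<-≤-trans (ℚ.positive⁻¹ 1ℚ) (fromℕ-mono {1} {suc n} (ℕ.s≤s ℕ.z≤n))

toℚᵘ-fromℕ : ∀ n → ℚ.toℚᵘ (fromℕ n) ℚᵘ.≃ ℚᵘ.mkℚᵘ (ℤ.+ n) 0
toℚᵘ-fromℕ zero    = ℚᵘ.≃-refl
toℚᵘ-fromℕ (suc n) = ℚᵘ.≃-trans (ℚ.toℚᵘ-homo-+ 1ℚ (fromℕ n))
  (ℚᵘ.≃-trans (ℚᵘ.+-congʳ ℚᵘ.1ℚᵘ (toℚᵘ-fromℕ n))
    (ℚᵘ.*≡* (cong (λ k → (ℤ.+ 1 ℤ.+ k) ℤ.* ℤ.+ 1) (ℤ.*-identityʳ (ℤ.+ n)))))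

-- The absolute value of the numerator is a threshold, since the denominator is at least 1.
archimedean : ∀ p → Eventually λ n → p ℚ.≤ fromℕ n
archimedean p@record{} = ℤ.∣ ℚ.↥ p ∣ , λ n le → ℚ.≤-trans p≤ (fromℕ-mono le)
  where
  num≤ : ∀ z → z ℤ.≤ ℤ.+ ℤ.∣ z ∣
  num≤ (ℤ.+ n)     = ℤ.≤-refl
  num≤ (ℤ.-[1+ n ]) = ℤ.-≤+

  p≤ : p ℚ.≤ fromℕ ℤ.∣ ℚ.↥ p ∣
  p≤ = ℚ.toℚᵘ-cancel-≤ (ℚᵘ.≤-trans
    (ℚᵘ.*≤* (ℤ.≤-trans (ℤ.≤-reflexive (ℤ.*-identityʳ (ℚ.↥ p)))
      (ℤ.≤-trans (num≤ (ℚ.↥ p))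
        (ℤ.≤-trans (ℤ.≤-reflexive (sym (ℤ.*-identityʳ _)))
          (ℤ.*-monoˡ-≤-nonNeg (ℤ.+ ℤ.∣ ℚ.↥ p ∣) (ℤ.+≤+ (ℕ.s≤s ℕ.z≤n)))))))
    (ℚᵘ.≤-reflexive (ℚᵘ.≃-sym (toℚᵘ-fromℕ ℤ.∣ ℚ.↥ p ∣))))

-- recip n is 1/(n + 1).
recip : ℕ → ℚ
recip n = proj₁ (inverse (0<fromℕ-suc n))

recip>0 : ∀ n → 0ℚ ℚ.< recip n
recip>0 n = proj₁ (proj₂ (inverse (0<fromℕ-suc n)))

recip-inverse : ∀ n → recip n ℚ.* fromℕ (suc n) ≡ 1ℚ
recip-inverse n = proj₂ (proj₂ (inverse (0<fromℕ-suc n)))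

-- Any `n` beyond `q / ε` works: multiply `q / ε ≤ n + 1` by `ε / (n + 1)`.
recip-small : ∀ q {ε} → 0ℚ ℚ.< ε → Eventually λ n → recip n ℚ.* q ℚ.≤ ε
recip-small q {ε} ε>0 = ev-map step (archimedean (r ℚ.* q))
  where
  r = proj₁ (inverse ε>0)

  step : ∀ n → r ℚ.* q ℚ.≤ fromℕ n → recip n ℚ.* q ℚ.≤ ε
  step n le = begin
    recip n ℚ.* q
      ≡⟨ cong (recip n ℚ.*_) (trans (sym (ℚ.*-identityˡ q))
           (cong (ℚ._* q) (sym (proj₂ (proj₂ (inverse ε>0)))))) ⟩
    recip n ℚ.* (r ℚ.* ε ℚ.* q)
      ≡⟨ solve 4 (λ s r ε q → s :* (r :* ε :* q) := s :* ε :* (r :* q)) refl (recip n) r ε q ⟩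
    recip n ℚ.* ε ℚ.* (r ℚ.* q)
      ≤⟨ *-monoˡ-≤ (ℚ.<⇒≤ (*-pos (recip>0 n) ε>0)) (ℚ.≤-trans le (fromℕ-suc n)) ⟩
    recip n ℚ.* ε ℚ.* fromℕ (suc n)
      ≡⟨ solve 3 (λ s ε k → s :* ε :* k := s :* k :* ε) refl (recip n) ε (fromℕ (suc n)) ⟩
    recip n ℚ.* fromℕ (suc n) ℚ.* ε
      ≡⟨ cong (ℚ._* ε) (recip-inverse n) ⟩
    1ℚ ℚ.* ε
      ≡⟨ ℚ.*-identityˡ ε ⟩
    ε ∎
    where open ℚ.≤-Reasoning

-- Terms for real numbers, their order and equality.

-- Expressions denoting reals. The operations on ℝ unfold to sequences and so
-- obstruct the inference of implicit arguments; constructors do not.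
infix  8 ⊝_
infixl 7 _·_
infixl 6 _⊕_ _⊖_

data Term : Set where
  ⌜_⌝     : ℝ → Term
  const   : ℚ → Term
  _⊕_ _⊖_ : Term → Term → Term
  ⊝_ ‖_‖  : Term → Term
  _·_     : ℚ → Term → Term

constant : ℚ → ℝ
constant q = mkℝ (λ _ → q) λ ε ε>0 → 0 , λ _ _ _ _ →
  subst (ℚ._≤ ε) (sym (cong ℚ.∣_∣ (ℚ.+-inverseʳ q))) (ℚ.<⇒≤ ε>0)

scale : ℚ → ℝ → ℝ
scale q x = mkℝ (λ n → q ℚ.* seq x n) λ ε ε>0 →
  let ε′ , ε′>0 , le = shrink q ε>0
      N , h = cauchy x ε′ ε′>0
  in N , λ m n N≤m N≤n → begin
    ℚ.∣ q ℚ.* seq x m ℚ.- q ℚ.* seq x n ∣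
      ≡⟨ cong ℚ.∣_∣ (solve 3 (λ q a b → q :* a :- q :* b := q :* (a :- b))
           refl q (seq x m) (seq x n)) ⟩
    ℚ.∣ q ℚ.* (seq x m ℚ.- seq x n) ∣
      ≡⟨ ℚ.∣p*q∣≡∣p∣*∣q∣ q _ ⟩
    ℚ.∣ q ∣ ℚ.* ℚ.∣ seq x m ℚ.- seq x n ∣
      ≤⟨ *-monoˡ-≤ (ℚ.0≤∣p∣ q) (h m n N≤m N≤n) ⟩
    ℚ.∣ q ∣ ℚ.* ε′
      ≤⟨ le ⟩
    ε ∎
  where open ℚ.≤-Reasoning

⟦_⟧ : Term → ℝ
⟦ ⌜ x ⌝ ⟧   = x
⟦ const q ⟧ = constant q
⟦ s ⊕ t ⟧   = ⟦ s ⟧ + ⟦ t ⟧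
⟦ s ⊖ t ⟧   = ⟦ s ⟧ - ⟦ t ⟧
⟦ ⊝ t ⟧     = - ⟦ t ⟧
⟦ ‖ t ‖ ⟧   = ∣ ⟦ t ⟧ ∣
⟦ q · t ⟧   = scale q ⟦ t ⟧

at : Term → ℕ → ℚ
at t = seq ⟦ t ⟧

infix 4 _≼_ _≅_

-- A record and not a synonym for `_≤_`: the synonym would unfold to sequences, while the record
-- type determines `s` and `t`.
record _≼_ (s t : Term) : Set where
  constructor ⟨_⟩
  field ≼⇒≤ : ⟦ s ⟧ ≤ ⟦ t ⟧

open _≼_ public

-- Two inequalities instead of a small absolute difference, so that linear reasoning about `_≼_`
-- carries over; `≅⇒≃` and `≃⇒≅` translate.
record _≅_ (s t : Term) : Set where
  constructor _⹁_
  field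
    ≅⇒≼ : s ≼ t
    ≅⇒≽ : t ≼ s

open _≅_ public

≼-pointwise : ∀ {x y} → (∀ n → at x n ℚ.≤ at y n) → x ≼ y
≼-pointwise {x} {y} h = ⟨ (λ ε ε>0 → always λ n → ℚ.≤-trans (h n)
  (subst (ℚ._≤ at y n ℚ.+ ε) (ℚ.+-identityʳ (at y n)) (ℚ.+-monoʳ-≤ (at y n) (ℚ.<⇒≤ ε>0)))) ⟩

≼-refl : ∀ {x} → x ≼ x
≼-refl = ≼-pointwise λ _ → ℚ.≤-refl

-- Linear consequences of inequalities between reals reduce to ring
-- identities between their terms.
≼-lin : ∀ {x y a b} → x ≼ y →
  (∀ n → at b n ℚ.+ at x n ≡ at y n ℚ.+ at a n) → a ≼ b
≼-lin {x} {y} {a} {b} ⟨ h ⟩ eq = ⟨ (λ ε ε>0 → ev-map (step ε) (h ε ε>0)) ⟩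
  where
  open ℚ.≤-Reasoning
  step : ∀ ε n → at x n ℚ.≤ at y n ℚ.+ ε → at a n ℚ.≤ at b n ℚ.+ ε
  step ε n le = +-cancelʳ-≤ (at y n) (begin
    at a n ℚ.+ at y n            ≡⟨ ℚ.+-comm (at a n) (at y n) ⟩
    at y n ℚ.+ at a n            ≡⟨ eq n ⟨
    at b n ℚ.+ at x n            ≤⟨ ℚ.+-monoʳ-≤ (at b n) le ⟩
    at b n ℚ.+ (at y n ℚ.+ ε)    ≡⟨ solve 3 (λ b y ε → b :+ (y :+ ε) := b :+ ε :+ y)
                                      refl (at b n) (at y n) ε ⟩
    at b n ℚ.+ ε ℚ.+ at y n      ∎)

infixr 6 _⊞_
_⊞_ : ∀ {x y z w} → x ≼ y → z ≼ w → x ⊕ z ≼ y ⊕ w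
_⊞_ {x} {y} {z} {w} ⟨ h ⟩ ⟨ k ⟩ = ⟨ (λ ε ε>0 →
  ev-zip (λ n p q → subst (at x n ℚ.+ at z n ℚ.≤_)
      (trans (solve 3 (λ y w η → (y :+ η) :+ (w :+ η) := y :+ w :+ (η :+ η))
               refl (at y n) (at w n) (½ ℚ.* ε))
             (cong (at y n ℚ.+ at w n ℚ.+_) (half+half ε)))
      (ℚ.+-mono-≤ p q))
    (h (½ ℚ.* ε) (half>0 ε>0)) (k (½ ℚ.* ε) (half>0 ε>0))) ⟩

≼-trans : ∀ {x y z} → x ≼ y → y ≼ z → x ≼ z
≼-trans {x} {y} {z} h k = ≼-lin (h ⊞ k) λ n →
  solve 3 (λ x y z → z :+ (x :+ y) := y :+ z :+ x) refl (at x n) (at y n) (at z n)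

≅-sym : ∀ {x y} → x ≅ y → y ≅ x
≅-sym (h ⹁ k) = k ⹁ h

≅-trans : ∀ {x y z} → x ≅ y → y ≅ z → x ≅ z
≅-trans (h ⹁ k) (h′ ⹁ k′) = ≼-trans h h′ ⹁ ≼-trans k′ k

≅-lin : ∀ {x y a b} → x ≅ y →
  (∀ n → at b n ℚ.+ at x n ≡ at y n ℚ.+ at a n) → a ≅ b
≅-lin {x} {y} {a} {b} (h ⹁ k) eq = ≼-lin h eq ⹁ ≼-lin k λ n →
  trans (ℚ.+-comm (at a n) (at y n)) (trans (sym (eq n)) (ℚ.+-comm (at b n) (at x n)))

⊞-cong : ∀ {x y z w} → x ≅ y → z ≅ w → x ⊕ z ≅ y ⊕ w
⊞-cong (h ⹁ k) (h′ ⹁ k′) = (h ⊞ h′) ⹁ (k ⊞ k′)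

≅-pointwise : ∀ {x y} → (∀ n → at x n ≡ at y n) → x ≅ y
≅-pointwise eq = ≼-pointwise (λ n → ℚ.≤-reflexive (eq n)) ⹁
  ≼-pointwise (λ n → ℚ.≤-reflexive (sym (eq n)))

⌜⟦_⟧⌝ : ∀ t → ⌜ ⟦ t ⟧ ⌝ ≅ t
⌜⟦ t ⟧⌝ = ≅-pointwise λ _ → refl

≅⇒≃ : ∀ {x y} → x ≅ y → ⟦ x ⟧ ≃ ⟦ y ⟧
≅⇒≃ {x} {y} (⟨ h ⟩ ⹁ ⟨ k ⟩) ε ε>0 = ev-zip
  (λ n p q → ∣p∣≤
    (subst (at x n ℚ.- at y n ℚ.≤_) (solve 2 (λ y ε → y :+ ε :- y := ε) refl (at y n) ε)
      (ℚ.+-monoˡ-≤ (ℚ.- at y n) p))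
    (subst₂ ℚ._≤_ (solve 2 (λ x y → y :- x := :- (x :- y)) refl (at x n) (at y n))
      (solve 2 (λ x ε → x :+ ε :- x := ε) refl (at x n) ε)
      (ℚ.+-monoˡ-≤ (ℚ.- at x n) q)))
  (h ε ε>0) (k ε ε>0)

≃⇒≅ : ∀ {x y} → ⟦ x ⟧ ≃ ⟦ y ⟧ → x ≅ y
≃⇒≅ {x} {y} h =
  ⟨ (λ ε ε>0 → ev-map (λ n → bound (at x n) (at y n)) (h ε ε>0)) ⟩ ⹁
  ⟨ (λ ε ε>0 → ev-map (λ n → bound (at y n) (at x n))
      (IsEquivalence.sym ≃-isEquivalence {⟦ x ⟧} {⟦ y ⟧} h ε ε>0)) ⟩
  where
  bound : ∀ p q {ε} → ℚ.∣ p ℚ.- q ∣ ℚ.≤ ε → p ℚ.≤ q ℚ.+ ε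
  bound p q {ε} le = subst (ℚ._≤ q ℚ.+ ε) (solve 2 (λ p q → q :+ (p :- q) := p) refl p q)
    (ℚ.+-monoʳ-≤ q (ℚ.≤-trans (p≤∣p∣ (p ℚ.- q)) le))

x≼‖x‖ : ∀ {x} → x ≼ ‖ x ‖
x≼‖x‖ {x} = ≼-pointwise λ n → p≤∣p∣ (at x n)

⊝x≼‖x‖ : ∀ {x} → ⊝ x ≼ ‖ x ‖
⊝x≼‖x‖ {x} = ≼-pointwise λ n → -p≤∣p∣ (at x n)

‖x‖≼ : ∀ {x y} → x ≼ y → ⊝ x ≼ y → ‖ x ‖ ≼ y
‖x‖≼ {x} ⟨ h ⟩ ⟨ k ⟩ = ⟨ (λ ε ε>0 → ev-zip (λ n → ∣p∣≤ {at x n}) (h ε ε>0) (k ε ε>0)) ⟩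

‖⊖‖-≽ : ∀ {x y} → y ≼ x → ‖ x ⊖ y ‖ ≅ x ⊖ y
‖⊖‖-≽ {x} {y} h = ‖x‖≼ ≼-refl (≼-lin (h ⊞ h) λ n →
  solve 2 (λ x y → x :- y :+ (y :+ y) := x :+ x :+ :- (x :- y)) refl (at x n) (at y n)) ⹁ x≼‖x‖

‖⊖‖-sym : ∀ {x y} → ‖ x ⊖ y ‖ ≅ ‖ y ⊖ x ‖
‖⊖‖-sym {x} {y} = ≃⇒≅ (MetricSpace.d-sym ℝ-space ⟦ x ⟧ ⟦ y ⟧)

‖⊖‖-≼ : ∀ {x y} → x ≼ y → ‖ x ⊖ y ‖ ≅ y ⊖ x
‖⊖‖-≼ h = ≅-trans ‖⊖‖-sym (‖⊖‖-≽ h)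

⊝-anti : ∀ {x y} → x ≼ y → ⊝ y ≼ ⊝ x
⊝-anti {x} {y} h = ≼-lin h λ n → solve 2 (λ x y → :- x :+ x := y :+ :- y) refl (at x n) (at y n)

‖‖-cong : ∀ {x y} → x ≅ y → ‖ x ‖ ≅ ‖ y ‖
‖‖-cong (h ⹁ k) =
  ‖x‖≼ (≼-trans h x≼‖x‖) (≼-trans (⊝-anti k) ⊝x≼‖x‖) ⹁
  ‖x‖≼ (≼-trans k x≼‖x‖) (≼-trans (⊝-anti h) ⊝x≼‖x‖)

·-mono : ∀ {q x y} → 0ℚ ℚ.≤ q → x ≼ y → q · x ≼ q · y
·-mono {q} {x} {y} q≥0 ⟨ h ⟩ = ⟨ (λ ε ε>0 →
  let ε′ , ε′>0 , le = shrink q ε>0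
  in ev-map (λ n p → begin
       q ℚ.* at x n                 ≤⟨ *-monoˡ-≤ q≥0 p ⟩
       q ℚ.* (at y n ℚ.+ ε′)        ≡⟨ ℚ.*-distribˡ-+ q (at y n) ε′ ⟩
       q ℚ.* at y n ℚ.+ q ℚ.* ε′    ≤⟨ ℚ.+-monoʳ-≤ (q ℚ.* at y n)
         (ℚ.≤-trans (ℚ.≤-reflexive (cong (ℚ._* ε′) (sym (ℚ.0≤p⇒∣p∣≡p q≥0)))) le) ⟩
       q ℚ.* at y n ℚ.+ ε           ∎)
     (h ε′ ε′>0)) ⟩
  where open ℚ.≤-Reasoning

·-cancel : ∀ {q x y} → 0ℚ ℚ.< q → q · x ≼ q · y → x ≼ y
·-cancel {q} {x} {y} q>0 h =
  let r , r>0 , eq = inverse q>0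
      undo : ∀ p → r ℚ.* (q ℚ.* p) ≡ p
      undo p = trans (sym (ℚ.*-assoc r q p)) (trans (cong (ℚ._* p) eq) (ℚ.*-identityˡ p))
  in ≼-lin (·-mono (ℚ.<⇒≤ r>0) h) λ n →
       trans (cong (at y n ℚ.+_) (undo (at x n))) (cong (ℚ._+ at x n) (sym (undo (at y n))))

<-const : ∀ {x y} → x < y → ∃[ ε ] (0ℚ ℚ.< ε × ⌜ x ⌝ ⊕ const ε ≼ ⌜ y ⌝)
<-const {x} {y} (ε , ε>0 , N , h) = ε , ε>0 ,
  ⟨ (λ η η>0 → N , λ n le → ℚ.≤-trans (h n le)
    (subst (ℚ._≤ seq y n ℚ.+ η) (ℚ.+-identityʳ (seq y n)) (ℚ.+-monoʳ-≤ (seq y n) (ℚ.<⇒≤ η>0)))) ⟩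

const-< : ∀ {x y ε} → 0ℚ ℚ.< ε → x ⊕ const ε ≼ y → ⟦ x ⟧ < ⟦ y ⟧
-- `_≼_` holds only up to arbitrarily small errors, whereas `_<_` asks for an exact eventual gap.
-- Half of `ε` is given up to absorb the error.
const-< {x} {y} {ε} ε>0 ⟨ h ⟩ = ½ ℚ.* ε , half>0 ε>0 , ev-map
  (λ n p → +-cancelʳ-≤ (½ ℚ.* ε) (subst (ℚ._≤ at y n ℚ.+ ½ ℚ.* ε)
    (trans (cong (at x n ℚ.+_) (sym (half+half ε))) (sym (ℚ.+-assoc (at x n) _ _))) p))
  (h (½ ℚ.* ε) (half>0 ε>0))

const-mono : ∀ {p q} → p ℚ.≤ q → const p ≼ const q
const-mono h = ≼-pointwise λ _ → h

const-cancel : ∀ {p q} → const p ≼ const q → p ℚ.≤ q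
-- If `q < p`, take `r` strictly between them: the hypothesis with error `r - q` gives `p ≤ r`,
-- against `r < p`.
const-cancel {p} {q} ⟨ h ⟩ = ℚ.≮⇒≥ λ q<p →
  let r , q<r , r<p = ℚ.<-dense q<p
      N , k = h (r ℚ.- q) (subst (ℚ._< r ℚ.- q) (ℚ.+-inverseʳ q) (ℚ.+-monoˡ-< (ℚ.- q) q<r))
  in ℚ.<-irrefl refl (ℚ.<-≤-trans r<p
       (subst (p ℚ.≤_) (solve 2 (λ q r → q :+ (r :- q) := r) refl q r) (k N ℕ.≤-refl)))

const-irrefl : ∀ {x y ε} → 0ℚ ℚ.< ε → x ⊕ const ε ≼ y → y ≼ x → ⊥
const-irrefl {x} {y} {ε} ε>0 h k = ℚ.<-irrefl refl (ℚ.<-≤-trans ε>0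
  (const-cancel {ε} {0ℚ} (≼-lin (h ⊞ k) λ n →
    solve 3 (λ x y ε → con 0ℚ :+ ((x :+ ε) :+ y) := y :+ x :+ ε) refl (at x n) (at y n) ε)))

bounded : ∀ x → ∃[ q ] x ≼ const q
bounded x with cauchy ⟦ x ⟧ 1ℚ (ℚ.positive⁻¹ 1ℚ)
... | N , h = at x N ℚ.+ 1ℚ , ⟨ (λ ε ε>0 → N , λ n le → begin
  at x n                       ≡⟨ solve 2 (λ a b → a := b :+ (a :- b)) refl (at x n) (at x N) ⟩
  at x N ℚ.+ (at x n ℚ.- at x N)
    ≤⟨ ℚ.+-monoʳ-≤ (at x N) (ℚ.≤-trans (p≤∣p∣ _) (h n N le ℕ.≤-refl)) ⟩
  at x N ℚ.+ 1ℚ                ≡⟨ ℚ.+-identityʳ _ ⟨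
  at x N ℚ.+ 1ℚ ℚ.+ 0ℚ         ≤⟨ ℚ.+-monoʳ-≤ (at x N ℚ.+ 1ℚ) (ℚ.<⇒≤ ε>0) ⟩
  at x N ℚ.+ 1ℚ ℚ.+ ε          ∎) ⟩
  where open ℚ.≤-Reasoning

bounded-ℕ : ∀ x → Eventually λ n → x ≼ const (fromℕ n)
bounded-ℕ x =
  let q , x≼q = bounded x
  in ev-map (λ n le → ≼-trans x≼q (const-mono le)) (archimedean q)

recip-small-· : ∀ x {ε} → 0ℚ ℚ.< ε → Eventually λ n → recip n · x ≼ const ε
recip-small-· x ε>0 =
  let q , x≼q = bounded x
  in ev-map
       (λ n le → ≼-trans (·-mono (ℚ.<⇒≤ (recip>0 n)) x≼q) (≼-pointwise λ _ → le))
       (recip-small q ε>0)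

-- Comparison of reals by excluded middle.

module Classical (em : ExcludedMiddle 0ℓ) where

  -- Suppose that there is no rational gap, and let `ε` be given. Past `K` each sequence moves by at
  -- most `ε / 4`. A single index `n` past `K` with `y + ε < x` would therefore force
  -- `y + ε / 2 ≤ x` at all indices past `K`, which is a gap of `ε / 2`.
  gap : ∀ x y → x ≼ y ⊎ ∃[ ε ] (0ℚ ℚ.< ε × y ⊕ const ε ≼ x)
  gap x y = case em {∃[ ε ] (0ℚ ℚ.< ε × y ⊕ const ε ≼ x)} of λ where
    (yes p)    → inj₂ p
    (no ¬gap) → inj₁ ⟨ (λ ε ε>0 →
      let η = ½ ℚ.* ε
          ζ = ½ ℚ.* η
          M , g = cauchy ⟦ x ⟧ ζ (half>0 (half>0 ε>0))
          N , h = cauchy ⟦ y ⟧ ζ (half>0 (half>0 ε>0))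
          K = M ℕ.⊔ N
      in case em {∃[ n ] (K ℕ.≤ n × at y n ℚ.+ ε ℚ.< at x n)} of λ where
        (no none) → K , λ n K≤n → ℚ.≮⇒≥ λ lt → none (n , K≤n , lt)
        (yes (n , K≤n , lt)) → contradiction
          (η , half>0 ε>0 , ⟨ (λ θ θ>0 → K , λ m K≤m →
            let open ℚ.≤-Reasoning
                M≤ : ∀ {k} → K ℕ.≤ k → M ℕ.≤ k
                M≤ = ℕ.≤-trans (ℕ.m≤m⊔n M N)
                N≤ : ∀ {k} → K ℕ.≤ k → N ℕ.≤ k
                N≤ = ℕ.≤-trans (ℕ.m≤n⊔m M N)
            in begin
              at y m ℚ.+ η
                ≡⟨ solve 3 (λ y y′ η → y :+ η := (y :- y′) :+ (y′ :+ η)) refl (at y m) (at y n) η ⟩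
              (at y m ℚ.- at y n) ℚ.+ (at y n ℚ.+ η)
                ≤⟨ ℚ.+-monoˡ-≤ (at y n ℚ.+ η)
                     (ℚ.≤-trans (p≤∣p∣ _) (h m n (N≤ K≤m) (N≤ K≤n))) ⟩
              ζ ℚ.+ (at y n ℚ.+ η)
                ≡⟨ solve 3 (λ ζ y η → ζ :+ (y :+ η) := y :+ (η :+ (ζ :+ ζ)) :- ζ) refl ζ (at y n) η ⟩
              at y n ℚ.+ (η ℚ.+ (ζ ℚ.+ ζ)) ℚ.- ζ
                ≡⟨ cong (λ q → at y n ℚ.+ q ℚ.- ζ)
                     (trans (cong (η ℚ.+_) (half+half η)) (half+half ε)) ⟩
              at y n ℚ.+ ε ℚ.- ζ
                ≤⟨ ℚ.+-monoˡ-≤ (ℚ.- ζ) (ℚ.<⇒≤ lt) ⟩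
              at x n ℚ.- ζ
                ≤⟨ ℚ.+-monoʳ-≤ (at x n) (ℚ.neg-antimono-≤
                     (ℚ.≤-trans (p≤∣p∣ _) (g n m (M≤ K≤n) (M≤ K≤m)))) ⟩
              at x n ℚ.- (at x n ℚ.- at x m)
                ≡⟨ solve 2 (λ x x′ → x :- (x :- x′) := x′) refl (at x n) (at x m) ⟩
              at x m
                ≡⟨ ℚ.+-identityʳ (at x m) ⟨
              at x m ℚ.+ 0ℚ
                ≤⟨ ℚ.+-monoʳ-≤ (at x m) (ℚ.<⇒≤ θ>0) ⟩
              at x m ℚ.+ θ ∎) ⟩)
          ¬gap) ⟩

  ≼-total : ∀ x y → x ≼ y ⊎ y ≼ x
  ≼-total x y = case gap x y of λ where
    (inj₁ x≼y)             → inj₁ x≼y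
    (inj₂ (ε , ε>0 , y+ε≼x)) → inj₂ (≼-lin (const-mono (ℚ.<⇒≤ ε>0) ⊞ y+ε≼x) λ n →
      solve 3 (λ x y ε → x :+ (con 0ℚ :+ (y :+ ε)) := ε :+ x :+ y) refl (at x n) (at y n) ε)

  minimum : ∀ {n} (f : Fin (suc n) → Term) → ∃[ i ] (∀ j → f i ≼ f j)
  minimum {zero}  f = zero , λ { zero → ≼-refl }
  minimum {suc n} f =
    let i , h = minimum (λ j → f (suc j))
    in case ≼-total (f zero) (f (suc i)) of λ where
      (inj₁ le) → zero , λ { zero → ≼-refl ; (suc j) → ≼-trans le (h j) }
      (inj₂ ge) → suc i , λ { zero → ge ; (suc j) → h j }

  -- A discrete intermediate value theorem: some jump of the chain from `a` through the values of
  -- `g` to `b` passes over `c`. Its length is at most `δ`, so an end of it that belongs to `g` is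
  -- within `δ` of `c`.
  crossing : ∀ {m a b c δ} (g : Fin (suc m) → Term) →
    (∀ i → ‖ g (Fin.inject₁ i) ⊖ g (suc i) ‖ ≼ δ) →
    ‖ a ⊖ g zero ‖ ≼ δ → ‖ g (Fin.fromℕ m) ⊖ b ‖ ≼ δ → a ≼ c → c ≼ b →
    ∃[ k ] ‖ g k ⊖ c ‖ ≼ δ
  crossing {m} {a} {b} {c} {δ} g step first last a≼c c≼b =
    case ≼-total (g zero) c of λ where
      (inj₁ g≼c) → below m g step last g≼c
      (inj₂ c≼g) → zero , ≼-trans (≅⇒≼ ‖⊖‖-sym) (closer-right a≼c c≼g first)
    where
    closer-left : ∀ {x y z} → x ≼ y → y ≼ z → ‖ x ⊖ z ‖ ≼ δ → ‖ x ⊖ y ‖ ≼ δ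
    closer-left {x} {y} {z} x≼y y≼z h = ≼-trans (≅⇒≼ (‖⊖‖-≼ x≼y))
      (≼-trans (≼-lin y≼z λ n →
        solve 3 (λ x y z → z :- x :+ y := z :+ (y :- x)) refl (at x n) (at y n) (at z n))
      (≼-trans (≅⇒≽ (‖⊖‖-≼ (≼-trans x≼y y≼z))) h))

    closer-right : ∀ {x y z} → x ≼ y → y ≼ z → ‖ x ⊖ z ‖ ≼ δ → ‖ y ⊖ z ‖ ≼ δ
    closer-right {x} {y} {z} x≼y y≼z h = ≼-trans (≅⇒≼ (‖⊖‖-≼ y≼z))
      (≼-trans (≼-lin x≼y λ n →
        solve 3 (λ x y z → z :- x :+ x := y :+ (z :- y)) refl (at x n) (at y n) (at z n))
      (≼-trans (≅⇒≽ (‖⊖‖-≼ (≼-trans x≼y y≼z))) h))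

    below : ∀ m (g : Fin (suc m) → Term) →
      (∀ i → ‖ g (Fin.inject₁ i) ⊖ g (suc i) ‖ ≼ δ) →
      ‖ g (Fin.fromℕ m) ⊖ b ‖ ≼ δ → g zero ≼ c → ∃[ k ] ‖ g k ⊖ c ‖ ≼ δ
    below zero    g step last g≼c = zero , closer-left g≼c c≼b last
    below (suc m) g step last g≼c = case ≼-total (g (suc zero)) c of λ where
      (inj₁ le) → let k , h = below m (λ i → g (suc i)) (λ i → step (suc i)) last le
                  in suc k , h
      (inj₂ ge) → zero , closer-left g≼c ge (step zero)

-- Equal subdivision of a segment.

·-nonneg : ∀ {q x} → 0ℚ ℚ.≤ q → const 0ℚ ≼ x → const 0ℚ ≼ q · x
·-nonneg {q} q≥0 x≥0 = ≼-trans (≼-pointwise λ _ → ℚ.≤-reflexive (sym (ℚ.*-zeroʳ q)))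
  (·-mono q≥0 x≥0)

·-monoˡ : ∀ {p q x} → p ℚ.≤ q → const 0ℚ ≼ x → p · x ≼ q · x
·-monoˡ {p} {q} {x} p≤q x≥0 = ≼-lin
  (·-nonneg {q ℚ.- p} (subst (ℚ._≤ q ℚ.- p) (ℚ.+-inverseʳ p) (ℚ.+-monoˡ-≤ (ℚ.- p) p≤q)) x≥0)
  λ n → solve 3 (λ p q x → q :* x :+ con 0ℚ := (q :- p) :* x :+ p :* x) refl p q (at x n)

-- Since `recip m` is `1 / (m + 1)`, the `m + 2` values cut the segment from 0 to `D` into `m + 1`
-- pieces, of which there is always at least one.
division : ∀ m → Term → Fin (suc (suc m)) → Term
division m D k = (fromℕ (Fin.toℕ k) ℚ.* recip m) · D

coefficient-mono : ∀ m {k l} → k ℕ.≤ l → fromℕ k ℚ.* recip m ℚ.≤ fromℕ l ℚ.* recip m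
coefficient-mono m {k} {l} k≤l = subst₂ ℚ._≤_
  (ℚ.*-comm (recip m) (fromℕ k)) (ℚ.*-comm (recip m) (fromℕ l))
  (*-monoˡ-≤ (ℚ.<⇒≤ (recip>0 m)) (fromℕ-mono k≤l))

module _ {m : ℕ} {D : Term} (D≥0 : const 0ℚ ≼ D) where

  division-first : division m D zero ≅ const 0ℚ
  division-first = ≅-pointwise λ n →
    trans (cong (ℚ._* at D n) (ℚ.*-zeroˡ (recip m))) (ℚ.*-zeroˡ (at D n))

  division-last : division m D (Fin.fromℕ (suc m)) ≅ D
  division-last = ≅-pointwise λ n → trans
    (cong (ℚ._* at D n) (trans (cong (λ k → fromℕ (suc k) ℚ.* recip m) (Fin.toℕ-fromℕ m))
      (trans (ℚ.*-comm (fromℕ (suc m)) (recip m)) (recip-inverse m))))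
    (ℚ.*-identityˡ (at D n))

  division≥0 : ∀ k → const 0ℚ ≼ division m D k
  division≥0 k = ≼-trans (≅⇒≽ division-first)
    (·-monoˡ (coefficient-mono m {0} {Fin.toℕ k} ℕ.z≤n) D≥0)

  division≤D : ∀ k → division m D k ≼ D
  division≤D k = ≼-trans
    (·-monoˡ (coefficient-mono m (ℕ.≤-trans (ℕ.s≤s⁻¹ (Fin.toℕ<n k))
      (ℕ.≤-reflexive (sym (Fin.toℕ-fromℕ (suc m)))))) D≥0)
    (≅⇒≼ division-last)

  division-step : ∀ k → ‖ division m D (Fin.inject₁ k) ⊖ division m D (suc k) ‖ ≅ recip m · D
  division-step k = ≅-trans
    (‖⊖‖-≼ (·-monoˡ (coefficient-mono m
      (ℕ.≤-trans (ℕ.≤-reflexive (Fin.toℕ-inject₁ k)) (ℕ.n≤1+n _))) D≥0))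
    (≅-pointwise λ n → trans
      (cong (λ j → fromℕ (suc (Fin.toℕ k)) ℚ.* recip m ℚ.* at D n ℚ.-
                   fromℕ j ℚ.* recip m ℚ.* at D n)
        (Fin.toℕ-inject₁ k))
      (solve 3 (λ j r d → (con 1ℚ :+ j) :* r :* d :- j :* r :* d := r :* d) refl
        (fromℕ (Fin.toℕ k)) (recip m) (at D n)))

-- Two of the three copies of `recip N` are the error allowed in `x`; the third remains as the
-- strict margin that gives the contradiction.
triple-gap : ∀ {x y ε} N → y ⊕ const ε ≼ x → recip N ℚ.* fromℕ 3 ℚ.≤ ε →
  x ≼ y ⊕ const (recip N ℚ.+ recip N) → ⊥
triple-gap {x} {y} {ε} N h small k = const-irrefl (recip>0 N)
  (≼-lin (h ⊞ const-mono small) λ n →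
    solve 4 (λ x y ε r →
        x :+ (y :+ ε :+ r :* (con 1ℚ :+ (con 1ℚ :+ (con 1ℚ :+ con 0ℚ))))
          := (x :+ ε) :+ (y :+ (r :+ r) :+ r))
      refl (at x n) (at y n) ε (recip N))
  k

-- Distances and geodesics in terms of `_≼_`.

module Distance {a b} (X : MetricSpace a b) where
  open MetricSpace X

  dist : Carrier → Carrier → Term
  dist x y = ⌜ d x y ⌝

  dist≥0 : ∀ x y → const 0ℚ ≼ dist x y
  dist≥0 x y = ⟨ d-nonneg x y ⟩

  dist-sym : ∀ x y → dist x y ≅ dist y x
  dist-sym x y = ≃⇒≅ (d-sym x y)

  dist-triangle : ∀ x y z → dist x z ≼ dist x y ⊕ dist y z
  dist-triangle x y z = ⟨ d-triangle x y z ⟩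

  ≈⇒dist≅0 : ∀ {x y} → x ≈ y → dist x y ≅ const 0ℚ
  ≈⇒dist≅0 {x} {y} x≈y = ≃⇒≅ (Equivalence.from (d≃0⇔≈ x y) x≈y)

  module _ {x y} (g : Geodesic X x y) where
    open Geodesic g

    γ-dist : ∀ s t → dist (γ s) (γ t) ≅ ‖ ⌜ proj₁ s ⌝ ⊖ ⌜ proj₁ t ⌝ ‖
    γ-dist s t = ≃⇒≅ (preserving s t)

    -- The geodesic starts at `x` only up to `_≈_`, so the triangle inequality is applied through
    -- its initial point, at distance 0 from `x`.
    γ-dist-start : ∀ t → dist x (γ t) ≼ ⌜ proj₁ t ⌝
    γ-dist-start t@(r , 0≤r , _) = ≼-lin
      (dist-triangle x (γ _) (γ t)
        ⊞ ≅⇒≼ (≅-trans (dist-sym x (γ _)) (≈⇒dist≅0 start))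
        ⊞ ≅⇒≼ (≅-trans (γ-dist _ t) (‖⊖‖-≼ {⌜ 0ℝ ⌝} ⟨ 0≤r ⟩)))
      λ n → solve 4 (λ r xt xs st →
          r :+ (xt :+ (xs :+ st)) := xs :+ st :+ (con 0ℚ :+ (r :- con 0ℚ)) :+ xt)
        refl (seq r n) (seq (d x (γ t)) n) (seq (d x (γ _)) n) (seq (d (γ _) (γ t)) n)

    γ-dist-end : ∀ t → dist (γ t) y ≼ dist x y ⊖ ⌜ proj₁ t ⌝
    γ-dist-end t@(r , _ , r≤D) = ≼-lin
      (dist-triangle (γ t) (γ _) y
        ⊞ ≅⇒≼ (≈⇒dist≅0 end)
        ⊞ ≅⇒≼ (≅-trans (γ-dist t _) (‖⊖‖-≼ {y = dist x y} ⟨ r≤D ⟩)))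
      λ n → solve 5 (λ r D ty te ey →
          D :- r :+ (ty :+ (ey :+ te)) := te :+ ey :+ (con 0ℚ :+ (D :- r)) :+ ty)
        refl (seq r n) (seq (d x y) n) (seq (d (γ t) y) n)
          (seq (d (γ t) (γ _)) n) (seq (d (γ _) y) n)

    point-at : ∀ {t} → const 0ℚ ≼ t → t ≼ dist x y →
      ∃[ w ] (dist x w ≼ t × dist w y ≼ dist x y ⊖ t)
    point-at {t} ⟨ 0≤t ⟩ ⟨ t≤D ⟩ = γ (⟦ t ⟧ , 0≤t , t≤D) ,
      ≼-trans (γ-dist-start _) (≅⇒≼ ⌜⟦ t ⟧⌝) ,
      ≼-trans (γ-dist-end _) (≼-pointwise λ _ → ℚ.≤-refl)

-- Isometric embedding of finite subsets in the line.

module FiniteEmbedding {a b} (em : ExcludedMiddle 0ℓ) (X : MetricSpace a b)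
  (geodesic : IsGeodesicSpace X) (UBG⊆ : UBG X ⊆ UBG ℝ-space) where

  open MetricSpace X using (Carrier; d)
  open Distance X
  open Classical em

  module Sampling {n} (P : Fin n → Carrier) {ε} (ε>0 : 0ℚ ℚ.< ε) (m : ℕ)
    (fine : ∀ i j → recip m · dist (P i) (P j) ≼ const ε) where

    -- One vertex for each given point, and `m + 2` samples on the chosen geodesic of each ordered
    -- pair. Vertices are indices, because different ones may mark the same point of the space.
    V : Set
    V = Fin n ⊎ (Fin n × Fin n × Fin (suc (suc m)))

    time : ∀ i j → Fin (suc (suc m)) → Σ ℝ [0, d (P i) (P j) ]
    time i j k = ⟦ division m (dist (P i) (P j)) k ⟧ ,
      ≼⇒≤ (division≥0 (dist≥0 (P i) (P j)) k) ,
      ≼⇒≤ (division≤D (dist≥0 (P i) (P j)) k)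

    time-≅ : ∀ i j k → ⌜ proj₁ (time i j k) ⌝ ≅ division m (dist (P i) (P j)) k
    time-≅ i j k = ⌜⟦ division m (dist (P i) (P j)) k ⟧⌝

    point : V → Carrier
    point (inj₁ i)           = P i
    point (inj₂ (i , j , k)) = Geodesic.γ (geodesic (P i) (P j)) (time i j k)

    G : Graph
    G = record
      { V           = V
      ; finite      = _ , ↔-sym (↔-trans Fin.+↔⊎
                        (↔-refl ⊎-↔ ↔-trans Fin.*↔× (↔-refl ×-↔ Fin.*↔×)))
      ; E           = λ u v → u ≢ v × d (point u) (point v) ≤ constant ε
      ; symmetric   = λ {u} {v} (u≢v , h) → (λ v≡u → u≢v (sym v≡u)) ,
                        ≼⇒≤ (≼-trans {z = const ε} (≅⇒≼ (dist-sym (point v) (point u))) ⟨ h ⟩)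
      ; irreflexive = λ u≡v (u≢v , _) → u≢v u≡v
      }

    UBG-G : UBG X G
    UBG-G = constant ε ,
      const-< {const 0ℚ} {const ε} ε>0 (≼-pointwise λ _ → ℚ.≤-reflexive (ℚ.+-identityˡ ε)) ,
      point , λ u v u≢v → mk⇔ proj₂ (u≢v ,_)

    δ : ℝ
    δ = proj₁ (UBG⊆ {G} UBG-G)

    f : V → Term
    f v = ⌜ proj₁ (proj₂ (proj₂ (UBG⊆ {G} UBG-G))) v ⌝

    close : ∀ u v → u ≢ v → dist (point u) (point v) ≼ const ε → ‖ f u ⊖ f v ‖ ≼ ⌜ δ ⌝
    close u v u≢v ⟨ h ⟩ =
      ⟨ Equivalence.to (proj₂ (proj₂ (proj₂ (UBG⊆ {G} UBG-G))) u v u≢v) (u≢v , h) ⟩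

    close⁻¹ : ∀ u v → u ≢ v → ‖ f u ⊖ f v ‖ ≼ ⌜ δ ⌝ → dist (point u) (point v) ≼ const ε
    close⁻¹ u v u≢v ⟨ h ⟩ =
      ⟨ proj₂ (Equivalence.from (proj₂ (proj₂ (proj₂ (UBG⊆ {G} UBG-G))) u v u≢v) h) ⟩

    φ : Fin n → Term
    φ i = f (inj₁ i)

    step : ∀ i j k →
      dist (point (inj₂ (i , j , Fin.inject₁ k))) (point (inj₂ (i , j , suc k))) ≼ const ε
    step i j k = ≼-trans (≅⇒≼ (γ-dist (geodesic (P i) (P j)) _ _))
      (≼-trans (≅⇒≼ (≅-trans (‖‖-cong (≅-pointwise λ _ → refl))
        (division-step (dist≥0 (P i) (P j)) k))) (fine i j))

    first : ∀ i j → dist (P i) (point (inj₂ (i , j , zero))) ≼ const ε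
    first i j = ≼-trans (γ-dist-start (geodesic (P i) (P j)) _)
      (≼-trans (≅⇒≼ (≅-trans (time-≅ i j zero) (division-first {m} (dist≥0 (P i) (P j)))))
        (const-mono (ℚ.<⇒≤ ε>0)))

    last : ∀ i j → dist (point (inj₂ (i , j , Fin.fromℕ (suc m)))) (P j) ≼ const ε
    last i j = ≼-trans (γ-dist-end (geodesic (P i) (P j)) _)
      (≼-lin (≅⇒≽ (≅-trans (time-≅ i j (Fin.fromℕ (suc m)))
            (division-last {m} (dist≥0 (P i) (P j))))
          ⊞ const-mono (ℚ.<⇒≤ ε>0))
        λ n → solve 3 (λ D t ε → ε :+ (D :+ con 0ℚ) := t :+ ε :+ (D :- t)) refl
          (at (dist (P i) (P j)) n) (seq (proj₁ (time i j (Fin.fromℕ (suc m)))) n) ε)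

    -- For a sample `w` of the geodesic, the distances from `P i` to `w` and from `w` to `P k` add
    -- up to at most that from `P i` to `P k`. Passing through `P j` instead costs the distance
    -- between `w` and `P j` twice, hence `ε + ε`.
    approximately-between : ∀ i j k → φ i ≼ φ j → φ j ≼ φ k →
      dist (P i) (P j) ⊕ dist (P j) (P k) ≼ dist (P i) (P k) ⊕ const (ε ℚ.+ ε)
    approximately-between i j k i≼j j≼k =
      let l , h = crossing (λ l → f (inj₂ (i , k , l)))
            -- `close` speaks of distinct vertices only; if consecutive samples had the same index,
            -- `toℕ l` would equal its own successor.
            (λ l → close _ _ (λ eq → ℕ.m≢1+m+n (Fin.toℕ l) (trans (sym (Fin.toℕ-inject₁ l))
                (trans (cong index eq) (cong suc (sym (ℕ.+-identityʳ (Fin.toℕ l)))))))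
              (step i k l))
            (close (inj₁ i) _ (λ ()) (first i k))
            (close _ (inj₁ k) (λ ()) (last i k)) i≼j j≼k
          w = point (inj₂ (i , k , l))
          t = proj₁ (time i k l)
          w-j = close⁻¹ _ (inj₁ j) (λ ()) h
      in ≼-lin
        (dist-triangle (P i) w (P j) ⊞ dist-triangle (P j) w (P k)
          ⊞ γ-dist-start (geodesic (P i) (P k)) (time i k l)
          ⊞ γ-dist-end (geodesic (P i) (P k)) (time i k l)
          ⊞ w-j ⊞ ≼-trans (≅⇒≼ (dist-sym (P j) w)) w-j)
        λ n → solve 9 (λ ij jk iw wj jw wk t ik ε →
            ik :+ (ε :+ ε) :+ (ij :+ (jk :+ (iw :+ (wk :+ (wj :+ jw)))))
              := iw :+ wj :+ (jw :+ wk :+ (t :+ (ik :- t :+ (ε :+ ε)))) :+ (ij :+ jk)) refl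
          (seq (d (P i) (P j)) n) (seq (d (P j) (P k)) n) (seq (d (P i) w) n) (seq (d w (P j)) n)
          (seq (d (P j) w) n) (seq (d w (P k)) n) (seq t n) (seq (d (P i) (P k)) n) ε
      where
      index : V → ℕ
      index (inj₁ _)           = 0
      index (inj₂ (_ , _ , k)) = Fin.toℕ k

  between : ∀ {n} (P : Fin n → Carrier) → Σ[ φ ∈ (Fin n → Term) ]
    (∀ i j k → φ i ≼ φ j → φ j ≼ φ k → dist (P i) (P j) ⊕ dist (P j) (P k) ≼ dist (P i) (P k))
  between {n} P =
    -- The gaps depend on distances in the space alone, so `N` can be fixed before any graph is
    -- built. Only then is `m` chosen, fine enough for `ε = recip N`.
    let N , sharp = ev-extract (ev-fin λ i → ev-fin λ j → ev-fin λ k → eventually-sharp i j k)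
        m , fine  = ev-extract (ev-fin λ i → ev-fin λ j →
          recip-small-· (dist (P i) (P j)) (recip>0 N))
        open Sampling P (recip>0 N) m fine
    in φ , λ i j k i≼j j≼k → sharp i j k (approximately-between i j k i≼j j≼k)
    where
    eventually-sharp : ∀ i j k → Eventually λ N →
      dist (P i) (P j) ⊕ dist (P j) (P k) ≼ dist (P i) (P k) ⊕ const (recip N ℚ.+ recip N) →
      dist (P i) (P j) ⊕ dist (P j) (P k) ≼ dist (P i) (P k)
    eventually-sharp i j k =
      case gap (dist (P i) (P j) ⊕ dist (P j) (P k)) (dist (P i) (P k)) of λ where
        (inj₁ le)             → always λ _ _ → le
        (inj₂ (ε , ε>0 , lt)) → ev-map (λ N small h → contradiction h (triple-gap N lt small))
          (recip-small (fromℕ 3) ε>0)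

  embedding : ∀ {n} (P : Fin (suc n) → Carrier) → Σ[ g ∈ (Fin (suc n) → Term) ]
    (∀ i j → ‖ g i ⊖ g j ‖ ≅ dist (P i) (P j))
  embedding P =
    let φ , btw = between P
        o , min = minimum φ
        g = λ i → dist (P o) (P i)
        ordered : ∀ i j → φ i ≼ φ j → ‖ g i ⊖ g j ‖ ≅ dist (P i) (P j)
        ordered i j le =
          -- `P o` is leftmost, so `P i` lies between `P o` and `P j`. Together with the triangle
          -- inequality this makes `g j - g i` the distance from `P i` to `P j`. The representation
          -- `φ` itself contributes only the order.
          let sum = btw o i j (min i) le
              Dij = seq (d (P i) (P j)) ; Doi = seq (d (P o) (P i)) ; Doj = seq (d (P o) (P j))
              g≼ : g i ≼ g j
              g≼ = ≼-lin (sum ⊞ dist≥0 (P i) (P j)) λ n →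
                solve 3 (λ ij oi oj → oj :+ (oi :+ ij :+ con 0ℚ) := oj :+ ij :+ oi)
                  refl (Dij n) (Doi n) (Doj n)
          in ≅-trans (‖⊖‖-≼ g≼)
            (≼-lin (dist-triangle (P o) (P i) (P j)) (λ n →
               solve 3 (λ ij oi oj → ij :+ oj := oi :+ ij :+ (oj :- oi))
                 refl (Dij n) (Doi n) (Doj n))
             ⹁ ≼-lin sum (λ n →
               solve 3 (λ ij oi oj → oj :- oi :+ (oi :+ ij) := oj :+ ij)
                 refl (Dij n) (Doi n) (Doj n)))
    in g , λ i j → case ≼-total (φ i) (φ j) of λ where
      (inj₁ le) → ordered i j le
      (inj₂ ge) → ≅-trans ‖⊖‖-sym (≅-trans (ordered j i ge) (dist-sym (P j) (P i)))

⊖-cong : ∀ {x y z w} → x ≅ y → z ≅ w → x ⊖ z ≅ y ⊖ w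
⊖-cong {x} {y} {z} {w} h k = ≅-lin (⊞-cong h (≅-sym k)) λ n →
  solve 4 (λ x y z w → y :- w :+ (x :+ w) := y :+ z :+ (x :- z))
    refl (at x n) (at y n) (at z n) (at w n)

‖⊖‖-zero : ∀ {x y} → ‖ x ⊖ y ‖ ≼ const 0ℚ → x ≅ y
‖⊖‖-zero {x} {y} h =
  ≼-lin (≼-trans x≼‖x‖ h) (λ n →
    solve 2 (λ x y → y :+ (x :- y) := con 0ℚ :+ x) refl (at x n) (at y n)) ⹁
  ≼-lin (≼-trans ⊝x≼‖x‖ h) (λ n →
    solve 2 (λ x y → x :+ (:- (x :- y)) := con 0ℚ :+ y) refl (at x n) (at y n))

-- Coordinates relative to two base points.

module Coordinate {a b} (em₀ : ExcludedMiddle 0ℓ) (X : MetricSpace a b)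
  (geodesic : IsGeodesicSpace X) (UBG⊆ : UBG X ⊆ UBG ℝ-space)
  (o e : MetricSpace.Carrier X) {ε} (ε>0 : 0ℚ ℚ.< ε)
  (apart : const ε ≼ ⌜ MetricSpace.d X o e ⌝) where

  open MetricSpace X using (Carrier; d)
  open Distance X
  open Classical em₀
  open FiniteEmbedding em₀ X geodesic (λ {G} → UBG⊆ {G})

  D : Term
  D = dist o e

  -- Both fields have the shape `‖ c ⊖ s ‖`, with centres 0 and `D`, so that `reflection` applies to
  -- each.
  record IsCoordinate (x : Carrier) (s : Term) : Set where
    constructor coordinate
    field
      from-o : ‖ const 0ℚ ⊖ s ‖ ≅ dist o x
      from-e : ‖ D ⊖ s ‖ ≅ dist e x

  -- On the same side of `c`, equal distances would make `s` and `t` equal, against the gap `η`.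
  -- Hence `c` lies between them.
  reflection : ∀ {s t c η} → 0ℚ ℚ.< η → t ⊕ const η ≼ s → ‖ c ⊖ s ‖ ≅ ‖ c ⊖ t ‖ →
    s ⊖ c ≅ c ⊖ t
  reflection {s} {t} {c} {η} η>0 t<s eq = case ≼-total t c of λ where
      (inj₂ c≼t) → contradiction
        (≼-lin (≅⇒≼ (≅-trans (≅-sym (‖⊖‖-≼ (≼-trans c≼t t≼s))) (≅-trans eq (‖⊖‖-≼ c≼t)))) λ n →
          solve 3 (λ s t c → t :+ (s :- c) := t :- c :+ s) refl (at s n) (at t n) (at c n))
        (const-irrefl η>0 t<s)
      (inj₁ t≼c) → case ≼-total s c of λ where
        (inj₁ s≼c) → contradiction
          (≼-lin (≅⇒≽ (≅-trans (≅-sym (‖⊖‖-≽ s≼c)) (≅-trans eq (‖⊖‖-≽ t≼c)))) λ n →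
            solve 3 (λ s t c → t :+ (c :- t) := c :- s :+ s) refl (at s n) (at t n) (at c n))
          (const-irrefl η>0 t<s)
        (inj₂ c≼s) → ≅-trans (≅-sym (‖⊖‖-≼ c≼s)) (≅-trans eq (‖⊖‖-≽ t≼c))
    where
    t≼s : t ≼ s
    t≼s = ≼-lin (const-mono (ℚ.<⇒≤ η>0) ⊞ t<s) λ n →
      solve 3 (λ s t η → s :+ (con 0ℚ :+ (t :+ η)) := η :+ s :+ t) refl (at s n) (at t n) η

  -- Distinct s and t with the same distances to 0 and to D would be mirror
  -- images of each other in both points.
  coordinate-≼ : ∀ {x s t} → IsCoordinate x s → IsCoordinate x t → s ≼ t
  coordinate-≼ {x} {s} {t} (coordinate so se) (coordinate to te) = case gap s t of λ where
    (inj₁ s≼t)            → s≼t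
    (inj₂ (η , η>0 , lt)) →
      let at-0 = reflection η>0 lt (≅-trans so (≅-sym to))
          at-D = reflection η>0 lt (≅-trans se (≅-sym te))
          D≼0 : D ≼ const 0ℚ
          D≼0 = ≼-lin (≅⇒≼ at-0 ⊞ ≅⇒≽ at-D ⊞ apart ⊞ const-mono (ℚ.<⇒≤ ε>0)) λ n →
            solve 4 (λ s t d ε →
                con 0ℚ :+ (s :- con 0ℚ :+ (d :- t :+ (ε :+ con 0ℚ)))
                  := con 0ℚ :- t :+ (s :- d :+ (d :+ ε)) :+ d)
              refl (at s n) (at t n) (at D n) ε
      in contradiction D≼0 (const-irrefl ε>0
           (≼-trans (≼-pointwise λ _ → ℚ.≤-reflexive (ℚ.+-identityˡ ε)) apart))

  coordinate-unique : ∀ {x s t} → IsCoordinate x s → IsCoordinate x t → s ≅ t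
  coordinate-unique c c′ = coordinate-≼ c c′ ⹁ coordinate-≼ c′ c

  -- A single embedding of `o`, `e`, `x` and `y` is translated, and also reflected if `e` lands to
  -- the left of `o`, so that `o` goes to 0 and `e` to `D`. As `x` and `y` share the embedding,
  -- their distance is preserved too.
  coordinates : ∀ x y → Σ[ s ∈ Term ] Σ[ t ∈ Term ]
    (IsCoordinate x s × IsCoordinate y t × ‖ s ⊖ t ‖ ≅ dist x y)
  coordinates x y =
    let P = lookup (o ∷ e ∷ x ∷ y ∷ [])
        g , iso = embedding P
        i0 = zero
        i1 = suc zero
        i2 = suc (suc zero)
        i3 = suc (suc (suc zero))
    in case ≼-total (g i0) (g i1) of λ where
      (inj₁ le) →
        let D≅ : D ≅ g i1 ⊖ g i0
            D≅ = ≅-trans (≅-sym (iso i0 i1)) (‖⊖‖-≼ le)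
            coord : ∀ i → IsCoordinate (P i) (g i ⊖ g i0)
            coord i = coordinate
              (≅-trans (‖‖-cong (≅-pointwise λ n →
                solve 2 (λ a o → con 0ℚ :- (a :- o) := o :- a)
                  refl (at (g i) n) (at (g i0) n))) (iso i0 i))
              (≅-trans (‖‖-cong (≅-lin D≅ λ n →
                solve 4 (λ a o e d → e :- a :+ d := e :- o :+ (d :- (a :- o))) refl
                  (at (g i) n) (at (g i0) n) (at (g i1) n) (at D n))) (iso i1 i))
        in g i2 ⊖ g i0 , g i3 ⊖ g i0 , coord i2 , coord i3 ,
          ≅-trans (‖‖-cong (≅-pointwise λ n →
            solve 3 (λ a b o → a :- o :- (b :- o) := a :- b)
              refl (at (g i2) n) (at (g i3) n) (at (g i0) n)))
            (iso i2 i3)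
      (inj₂ ge) →
        let D≅ : D ≅ g i0 ⊖ g i1
            D≅ = ≅-trans (≅-sym (iso i0 i1)) (‖⊖‖-≽ ge)
            coord : ∀ i → IsCoordinate (P i) (g i0 ⊖ g i)
            coord i = coordinate
              (≅-trans ‖⊖‖-sym (≅-trans (‖‖-cong (≅-pointwise λ n →
                solve 2 (λ a o → o :- a :- con 0ℚ := o :- a)
                  refl (at (g i) n) (at (g i0) n))) (iso i0 i)))
              (≅-trans ‖⊖‖-sym (≅-trans (‖‖-cong (≅-lin (≅-sym D≅) λ n →
                solve 4 (λ a o e d → e :- a :+ (o :- e) := d :+ (o :- a :- d)) refl
                  (at (g i) n) (at (g i0) n) (at (g i1) n) (at D n))) (iso i1 i)))
        in g i0 ⊖ g i2 , g i0 ⊖ g i3 , coord i2 , coord i3 ,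
          ≅-trans ‖⊖‖-sym (≅-trans (‖‖-cong (≅-pointwise λ n →
            solve 3 (λ a b o → o :- b :- (o :- a) := a :- b)
              refl (at (g i2) n) (at (g i3) n) (at (g i0) n)))
            (iso i2 i3))

  -- The point `x` fills both free places of the four-point set; by `coordinate-unique` another
  -- choice for the second place would give an equal value.
  F : Carrier → Term
  F x = proj₁ (coordinates x x)

  F-coordinate : ∀ x → IsCoordinate x (F x)
  F-coordinate x = proj₁ (proj₂ (proj₂ (coordinates x x)))

  -- `F x` and `F y` come from different embeddings. Uniqueness replaces them by the coordinates
  -- from a common embedding of `x` and `y`.
  F-isometry : ∀ x y → ‖ F x ⊖ F y ‖ ≅ dist x y
  F-isometry x y =
    let s , t , cs , ct , eq = coordinates x y
    in ≅-trans (‖‖-cong (⊖-cong (coordinate-unique (F-coordinate x) cs)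
         (coordinate-unique (F-coordinate y) ct))) eq

-- The image of the isometry is an interval.

module Image {a b} (em : ExcludedMiddle a) (X : MetricSpace a b) (geodesic : IsGeodesicSpace X)
  (F : MetricSpace.Carrier X → Term)
  (F-isometry : ∀ x y → ‖ F x ⊖ F y ‖ ≅ ⌜ MetricSpace.d X x y ⌝) where

  open MetricSpace X using (Carrier; d)
  open Distance X

  F-injective : ∀ {x y} → dist x y ≼ const 0ℚ → F x ≅ F y
  F-injective {x} {y} h = ‖⊖‖-zero (≼-trans (≅⇒≼ (F-isometry x y)) h)

  -- True brings the statement down to the lowest universe.
  I : Pred ℝ 0ℓ
  I t = True (em {∃[ x ] ⌜ t ⌝ ≅ F x})

  F∈I : ∀ x → I ⟦ F x ⟧
  F∈I x = fromWitness (x , ⌜⟦ F x ⟧⌝)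

  -- The distances of w to p and q bound F w on either side by z.
  F-between : ∀ {p q w x y z} → x ≅ F p → y ≅ F q →
    dist p w ≼ z ⊖ x → dist w q ≼ y ⊖ z → z ≅ F w
  F-between {p} {q} {w} {x} {y} {z} x≅Fp y≅Fq pw wq =
    ≼-lin (≅⇒≼ y≅Fq ⊞ ⊝x≼‖x‖ {F w ⊖ F q} ⊞ ≅⇒≼ (F-isometry w q) ⊞ wq) (λ n →
      solve 6 (λ y z fq fw a wq → fw :+ (y :+ (:- (fw :- fq) :+ (a :+ wq)))
          := fq :+ (a :+ (wq :+ (y :- z))) :+ z)
        refl (at y n) (at z n) (at (F q) n) (at (F w) n) (at ‖ F w ⊖ F q ‖ n) (seq (d w q) n)) ⹁
    ≼-lin (≅⇒≽ x≅Fp ⊞ ⊝x≼‖x‖ {F p ⊖ F w} ⊞ ≅⇒≼ (F-isometry p w) ⊞ pw) (λ n →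
      solve 6 (λ x z fp fw a pw → z :+ (fp :+ (:- (fp :- fw) :+ (a :+ pw)))
          := x :+ (a :+ (pw :+ (z :- x))) :+ fw)
        refl (at x n) (at z n) (at (F p) n) (at (F w) n) (at ‖ F p ⊖ F w ‖ n) (seq (d p w) n))

  -- The geodesic from `p` to `q` has length `y - x`; its point at time `z - x` is the required `w`.
  F-connected : ∀ {p q x y z} → x ≅ F p → y ≅ F q → x ≼ z → z ≼ y → ∃[ w ] z ≅ F w
  F-connected {p} {q} {x} {y} {z} x≅Fp y≅Fq x≼z z≼y =
    let w , pw , wq = point-at (geodesic p q) 0≼t t≼pq
    in w , F-between x≅Fp y≅Fq pw (≼-trans wq (≼-lin (≅⇒≼ pq≅) λ n →
         solve 4 (λ x y z pq → y :- z :+ pq := y :- x :+ (pq :- (z :- x))) refl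
           (at x n) (at y n) (at z n) (seq (d p q) n)))
    where
    pq≅ : dist p q ≅ y ⊖ x
    pq≅ = ≅-trans (≅-sym (F-isometry p q))
      (≅-trans (‖‖-cong (⊖-cong (≅-sym x≅Fp) (≅-sym y≅Fq))) (‖⊖‖-≼ (≼-trans x≼z z≼y)))

    0≼t : const 0ℚ ≼ z ⊖ x
    0≼t = ≼-lin x≼z λ n → solve 2 (λ x z → z :- x :+ x := z :+ con 0ℚ) refl (at x n) (at z n)

    t≼pq : z ⊖ x ≼ dist p q
    t≼pq = ≼-trans (≼-lin z≼y λ n →
      solve 3 (λ x y z → y :- x :+ z := y :+ (z :- x)) refl (at x n) (at y n) (at z n)) (≅⇒≽ pq≅)

  I-convex : Convex I
  I-convex x y z x∈I y∈I x≤z z≤y =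
    let _ , x≅Fp = toWitness x∈I
        _ , y≅Fq = toWitness y∈I
    in fromWitness (F-connected x≅Fp y≅Fq ⟨ x≤z ⟩ ⟨ z≤y ⟩)

  I-nontrivial : ∀ {o e ε} → 0ℚ ℚ.< ε → const ε ≼ dist o e →
    ¬ IsSinglePoint (Subspace ℝ-space I)
  I-nontrivial {o} {e} {ε} ε>0 apart ((t , _) , h) = const-irrefl {const 0ℚ} {dist o e} ε>0
    (≼-trans (≼-pointwise λ _ → ℚ.≤-reflexive (ℚ.+-identityˡ ε)) apart)
    (≼-trans (≅⇒≽ (F-isometry o e)) (≼-trans (≅⇒≼ (‖‖-cong (⊖-cong Fo≅t Fe≅t)))
      (≅⇒≼ (≅-trans (‖⊖‖-≽ {⌜ t ⌝} ≼-refl) (≅-pointwise λ n → ℚ.+-inverseʳ (seq t n))))))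
    where
    Fo≅t : F o ≅ ⌜ t ⌝
    Fo≅t = ≃⇒≅ (h (⟦ F o ⟧ , F∈I o))
    Fe≅t : F e ≅ ⌜ t ⌝
    Fe≅t = ≃⇒≅ (h (⟦ F e ⟧ , F∈I e))

  X-isometric-I : Isometric X (Subspace ℝ-space I)
  X-isometric-I = (λ x → ⟦ F x ⟧ , F∈I x) , (λ x y → ≅⇒≃ (F-isometry x y)) , λ (t , t∈I) →
    let x , t≅Fx = toWitness t∈I
    in x , λ {z} z≈x → ≅⇒≃ (≅-trans (F-injective (≅⇒≼ (≈⇒dist≅0 z≈x))) (≅-sym t≅Fx))

-- Two points at positive distance.

edgeless : Graph
edgeless = record
  { V = Fin 2 ; finite = 2 , ↔-refl ; E = λ _ _ → ⊥ ; symmetric = λ () ; irreflexive = λ _ () }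

UBG-edgeless : UBG ℝ-space edgeless
UBG-edgeless = constant 1ℚ ,
  const-< {const 0ℚ} {const 1ℚ} (ℚ.positive⁻¹ 1ℚ)
    (≼-pointwise λ _ → ℚ.≤-reflexive (ℚ.+-identityˡ 1ℚ)) ,
  (λ v → constant (position v)) , λ u v u≢v → mk⇔ (λ ())
    λ h → far u v u≢v (const-cancel {ℚ.∣ position u ℚ.- position v ∣} {1ℚ} ⟨ h ⟩)
  where
  position : Fin 2 → ℚ
  position zero    = 0ℚ
  position (suc _) = fromℕ 2

  1<2 : 1ℚ ℚ.< fromℕ 2
  1<2 = ℚ.*<* (ℤ.+<+ (ℕ.s≤s (ℕ.s≤s ℕ.z≤n)))

  far : ∀ u v → u ≢ v → ℚ.∣ position u ℚ.- position v ∣ ℚ.≤ 1ℚ → ⊥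
  far zero       zero       u≢v _ = u≢v refl
  far zero       (suc zero) _   h = ℚ.<-irrefl refl (ℚ.<-≤-trans 1<2 h)
  far (suc zero) zero       _   h = ℚ.<-irrefl refl (ℚ.<-≤-trans 1<2 h)
  far (suc zero) (suc zero) u≢v _ = u≢v refl

module _ {a b} (em : ExcludedMiddle (a ⊔ b)) (X : MetricSpace a b) where
  open MetricSpace X using (Carrier; d)
  open Distance X

  private
    em₀ : ExcludedMiddle 0ℓ
    em₀ = em-lower (a ⊔ b) em

  open Classical em₀

  -- Two vertices without an edge must be represented at a distance exceeding `δ` by some rational
  -- `ε`. As `δ` is positive, this `ε` also bounds the distance from below.
  apart-points : UBG ℝ-space ⊆ UBG X →
    ∃[ o ] ∃[ e ] ∃[ ε ] (0ℚ ℚ.< ε × const ε ≼ dist o e)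
  apart-points ⊇UBG =
    let δ , δ>0 , ρ , edge = ⊇UBG {edgeless} UBG-edgeless
        o = ρ zero
        e = ρ (suc zero)
        η , η>0 , 0+η≼δ = <-const {0ℝ} {δ} δ>0
    in o , e , (case gap (dist o e) ⌜ δ ⌝ of λ where
      (inj₁ le) → contradiction (≼⇒≤ le) (Equivalence.from (edge zero (suc zero) λ ()))
      (inj₂ (ε , ε>0 , lt)) → ε , ε>0 , ≼-lin (lt ⊞ 0+η≼δ ⊞ const-mono (ℚ.<⇒≤ η>0)) λ n →
        solve 4 (λ D δ ε η → D :+ (δ :+ ε :+ (con 0ℚ :+ η :+ con 0ℚ)) := D :+ (δ :+ η) :+ ε) refl
          (seq (d o e) n) (seq δ n) ε η)

  UBG≐⇒interval : IsGeodesicSpace X → UBG X ≐ UBG ℝ-space →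
    Σ[ I ∈ Pred ℝ 0ℓ ] (Convex I × ¬ IsSinglePoint (Subspace ℝ-space I)
      × Isometric X (Subspace ℝ-space I))
  UBG≐⇒interval geodesic (UBG⊆ , ⊇UBG) =
    let o , e , ε , ε>0 , apart = apart-points (λ {G} → ⊇UBG {G})
        open Coordinate em₀ X geodesic (λ {G} → UBG⊆ {G}) o e ε>0 apart
        open Image (em-lower b em) X geodesic F F-isometry
    in I , I-convex , I-nontrivial ε>0 apart , X-isometric-I

  -- From intervals to unit ball graphs.

  module _ {p} {I : Pred ℝ p} (iso : Isometric X (Subspace ℝ-space I)) where
    private
      f : Carrier → Term
      f x = ⌜ proj₁ (proj₁ iso x) ⌝

    f-isometry : ∀ x y → ‖ f x ⊖ f y ‖ ≅ dist x y
    f-isometry x y = ≃⇒≅ (proj₁ (proj₂ iso) x y)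

    isometric⇒UBG⊆ : UBG X ⊆ UBG ℝ-space
    isometric⇒UBG⊆ (δ , δ>0 , ρ , edge) = δ , δ>0 , (λ v → ⟦ f (ρ v) ⟧) , λ u v u≢v → mk⇔
      (λ uv → ≼⇒≤ (≼-trans {z = ⌜ δ ⌝} (≅⇒≼ (f-isometry (ρ u) (ρ v)))
        ⟨ Equivalence.to (edge u v u≢v) uv ⟩))
      (λ h → Equivalence.from (edge u v u≢v)
        (≼⇒≤ (≼-trans {z = ⌜ δ ⌝} (≅⇒≽ (f-isometry (ρ u) (ρ v))) ⟨ h ⟩)))

    -- The map `r ↦ lo + s (r + M)` multiplies distances by `s`, hence the threshold becomes
    -- `s · δ`. Convexity keeps the images in `I`, and surjectivity of the isometry lifts them to
    -- the space.
    segment⇒⊇UBG : Convex I → ∀ {lo hi ε} → I lo → I hi → 0ℚ ℚ.< ε →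
      ⌜ lo ⌝ ⊕ const ε ≼ ⌜ hi ⌝ → UBG ℝ-space ⊆ UBG X
    segment⇒⊇UBG convex {lo} {hi} {ε} lo∈I hi∈I ε>0 lo+ε≼hi {G} (δ , δ>0 , ρ , edge) =
      ⟦ s · ⌜ δ ⌝ ⟧ , sδ>0 , point , λ u v u≢v → mk⇔
        (λ uv → ≼⇒≤ (≼-trans {z = s · ⌜ δ ⌝} (≅⇒≼ (point-dist u v))
          (·-mono {s} {‖ ⌜ ρ u ⌝ ⊖ ⌜ ρ v ⌝ ‖} (ℚ.<⇒≤ s>0) ⟨ Equivalence.to (edge u v u≢v) uv ⟩)))
        (λ h → Equivalence.from (edge u v u≢v)
          (≼⇒≤ (·-cancel {s} {‖ ⌜ ρ u ⌝ ⊖ ⌜ ρ v ⌝ ‖} {⌜ δ ⌝} s>0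
            (≼-trans {z = s · ⌜ δ ⌝} (≅⇒≽ (point-dist u v)) ⟨ h ⟩))))
      where
      open Graph G
      open Inverse (proj₂ finite) using (to; from; strictlyInverseʳ)

      bound : ∃[ N ] (∀ i → ‖ ⌜ ρ (from i) ⌝ ‖ ≼ const (fromℕ N))
      bound = ev-extract (ev-fin λ i → bounded-ℕ ‖ ⌜ ρ (from i) ⌝ ‖)

      M : ℚ
      M = fromℕ (proj₁ bound)

      ρ-bound : ∀ v → ‖ ⌜ ρ v ⌝ ‖ ≼ const M
      ρ-bound v = subst (λ w → ‖ ⌜ ρ w ⌝ ‖ ≼ const M) (strictlyInverseʳ v) (proj₂ bound (to v))

      -- All vertices lie between `-M` and `M`. The scaled copy of that segment, of length
      -- `s (M + M)`, has to fit into the room `ε` between `lo` and `hi`; choosing `s` among the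
      -- reciprocals avoids dividing by `M`, which may be 0.
      small : ∃[ m ] recip m · (const M ⊕ const M) ≼ const ε
      small = ev-extract (recip-small-· (const M ⊕ const M) ε>0)

      s : ℚ
      s = recip (proj₁ small)

      s>0 : 0ℚ ℚ.< s
      s>0 = recip>0 (proj₁ small)

      sδ>0 : 0ℝ < ⟦ s · ⌜ δ ⌝ ⟧
      sδ>0 =
        let η , η>0 , 0+η≼δ = <-const {0ℝ} {δ} δ>0
        in const-< {const 0ℚ} {s · ⌜ δ ⌝} (*-pos s>0 η>0)
          (≼-trans (≼-pointwise λ n → ℚ.≤-reflexive
            (solve 2 (λ s η → con 0ℚ :+ s :* η := s :* (con 0ℚ :+ η)) refl s η))
            (·-mono (ℚ.<⇒≤ s>0) 0+η≼δ))

      σ : V → Term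
      σ v = ⌜ lo ⌝ ⊕ s · (⌜ ρ v ⌝ ⊕ const M)

      σ∈I : ∀ v → I ⟦ σ v ⟧
      σ∈I v = convex lo hi ⟦ σ v ⟧ lo∈I hi∈I (≼⇒≤ lo≼σ) (≼⇒≤ σ≼hi)
        where
        lo≼σ : ⌜ lo ⌝ ≼ σ v
        lo≼σ = ≼-lin (·-nonneg {x = ⌜ ρ v ⌝ ⊕ const M} (ℚ.<⇒≤ s>0)
          (≼-lin (≼-trans ⊝x≼‖x‖ (ρ-bound v)) λ n →
            solve 2 (λ r M → r :+ M :+ (:- r) := M :+ con 0ℚ) refl (seq (ρ v) n) M))
          λ n → solve 4 (λ lo s r M → lo :+ s :* (r :+ M) :+ con 0ℚ := s :* (r :+ M) :+ lo) refl
            (seq lo n) s (seq (ρ v) n) M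
        σ≼hi : σ v ≼ ⌜ hi ⌝
        σ≼hi = ≼-lin (·-mono (ℚ.<⇒≤ s>0) (≼-trans x≼‖x‖ (ρ-bound v)) ⊞ proj₂ small ⊞ lo+ε≼hi)
          λ n → solve 6 (λ lo hi s r M ε →
              hi :+ (s :* r :+ (s :* (M :+ M) :+ (lo :+ ε)))
                := s :* M :+ (ε :+ hi) :+ (lo :+ s :* (r :+ M)))
            refl (seq lo n) (seq hi n) s (seq (ρ v) n) M ε

      point : V → Carrier
      point v = proj₁ (proj₂ (proj₂ iso) (⟦ σ v ⟧ , σ∈I v))

      f-point : ∀ v → f (point v) ≅ σ v
      f-point v = ≃⇒≅ (proj₂ (proj₂ (proj₂ iso) (⟦ σ v ⟧ , σ∈I v))
        (IsEquivalence.refl (MetricSpace.isEquivalence X)))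

      point-dist : ∀ u v → dist (point u) (point v) ≅ s · ‖ ⌜ ρ u ⌝ ⊖ ⌜ ρ v ⌝ ‖
      point-dist u v = ≅-trans (≅-sym (f-isometry (point u) (point v)))
        (≅-trans (‖‖-cong (⊖-cong (f-point u) (f-point v))) (≅-pointwise λ n →
          trans (cong ℚ.∣_∣ (solve 5 (λ lo s M a b →
                  lo :+ s :* (a :+ M) :- (lo :+ s :* (b :+ M)) := s :* (a :- b)) refl
                  (seq lo n) s M (seq (ρ u) n) (seq (ρ v) n)))
            (trans (ℚ.∣p*q∣≡∣p∣*∣q∣ s _)
              (cong (ℚ._* ℚ.∣ seq (ρ u) n ℚ.- seq (ρ v) n ∣) (ℚ.0≤p⇒∣p∣≡p (ℚ.<⇒≤ s>0))))))

  -- An empty `I` would not be a single point either; the image `t` of `x₀` excludes this case. So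
  -- `I` contains some `y` different from `t`, and `gap` finds a rational margin on one side or the
  -- other.
  interval⇒UBG≐ : Carrier → {I : Pred ℝ 0ℓ} → Convex I → ¬ IsSinglePoint (Subspace ℝ-space I) →
    Isometric X (Subspace ℝ-space I) → UBG X ≐ UBG ℝ-space
  interval⇒UBG≐ x₀ {I} convex nontrivial iso@(f , _) =
    (λ {G} → isometric⇒UBG⊆ iso {G}) , λ {G} G∈ →
      case em₀ {∃[ y ] (I y × ¬ y ≃ t)} of λ where
        (no none) → contradiction
          ((t , t∈I) , λ (y , y∈I) → case em₀ {y ≃ t} of λ where
            (yes y≃t) → y≃t
            (no  y≄t) → contradiction (y , y∈I , y≄t) none)
          nontrivial
        (yes (y , y∈I , y≄t)) → case gap ⌜ y ⌝ ⌜ t ⌝ of λ where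
          (inj₂ (ε , ε>0 , t<y)) → segment⇒⊇UBG iso convex t∈I y∈I ε>0 t<y {G} G∈
          (inj₁ y≼t) → case gap ⌜ t ⌝ ⌜ y ⌝ of λ where
            (inj₂ (ε , ε>0 , y<t)) → segment⇒⊇UBG iso convex y∈I t∈I ε>0 y<t {G} G∈
            (inj₁ t≼y) → contradiction (≅⇒≃ (y≼t ⹁ t≼y)) y≄t
    where
    t   = proj₁ (f x₀)
    t∈I = proj₂ (f x₀)

corollary1p13 : ∀ {a b} → ExcludedMiddle (a ⊔ b) →
    (X : MetricSpace a b) → IsGeodesicSpace X → MetricSpace.Carrier X →
    (UBG X ≐ UBG ℝ-space) ⇔
    (Σ[ I ∈ Pred ℝ 0ℓ ] (Convex I
      × ¬ IsSinglePoint (Subspace ℝ-space I)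
      × Isometric X (Subspace ℝ-space I)))
corollary1p13 em X geodesic x₀ = mk⇔ (UBG≐⇒interval em X geodesic)
  λ (I , convex , nontrivial , iso) → interval⇒UBG≐ em X x₀ convex nontrivial iso
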